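{- Let $\beta,\gamma$ be real numbers with $\gamma\neq 0$. Let $G$ be a simple graph with vertex set $V(G)=\{v_1,\dots,v_n\}$ and edge set $E(G)=\{e_1,\dots,e_m\}$, with diagonal matrix of vertex degrees $D$ and adjacency matrix $A$. Let $\tau_1(G;x)=\det(xI_n-\beta D-\gamma A)$ and $\tau_2(G;x)=\mathrm{per}(xI_n-\beta D-\gamma A)$. Then $$(m-n)\tau_1(G;x)+x\tau_1'(G;x)=\sum_{e\in E(G)}\tau_1(G-e;x)+(\gamma^2-\beta^2)\sum_{v_sv_t\in E(G)}\det\left[(xI_n-\beta D-\gamma A)^{s,t}_{s,t}\right]$$ and $$(m-n)\tau_2(G;x)+x\tau_2'(G;x)=\sum_{e\in E(G)}\tau_2(G-e;x)-(\gamma^2+\beta^2)\sum_{v_sv_t\in E(G)}\mathrm{per}\left[(xI_n-\beta D-\gamma A)^{s,t}_{s,t}\right].$$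
   Context: Graphs are finite and simple. $\mathrm{per}(X)=\sum_{\alpha\in S_n}\prod_{k=1}^n x_{k\alpha(k)}$ is the permanent. $M^{s,t}_{s,t}$ denotes the submatrix of $M$ obtained by deleting rows $s,t$ and columns $s,t$; the determinant and permanent of the empty matrix are $1$. $G-e$ is $G$ with the edge $e$ deleted (keeping all vertices), and $\tau_1(G-e;x)$, $\tau_2(G-e;x)$ are defined by the same formulas using the degree matrix and adjacency matrix of $G-e$ and the same $\beta,\gamma$. The prime denotes the derivative with respect to $x$. Sums over $E(G)$ have one term per (undirected) edge. -}

module Defs where

open import Algebra.Bundles using (RawRing; CommutativeRing)
open import Algebra.Structures using (IsCommutativeRing)
import Algebra.Definitions.RawSemiring as RawSemiringDefinitions
open import Data.Bool using (Bool; true; false; T; T?; _∧_; _∨_; not; if_then_else_)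
open import Data.Bool.Properties using (∧-comm; ∨-comm)
open import Data.Fin as Fin using (Fin; zero; suc; _<?_)
open import Data.Fin.Properties using (_≟_; punchIn-injective)
open import Data.Fin.Permutation using (Permutation′; _⟨$⟩ʳ_; insert; remove; punchIn-permute) renaming (id to idₚ)
open import Data.List using (List; []; _∷_; map; foldr; length; filter; allFin; cartesianProduct; cartesianProductWith; lookup)
open import Data.List.Membership.Propositional.Properties using (∈-allFin)
open import Data.List.Relation.Unary.All using ([])
open import Data.List.Relation.Unary.AllPairs using ([]; _∷_)
open import Data.List.Relation.Unary.Any using (Any; here)
open import Data.List.Relation.Unary.Any.Properties using (cartesianProductWith⁺)
open import Data.List.Relation.Unary.Unique.Propositional.Properties using (allFin⁺)
open import Data.List.Relation.Unary.Unique.Setoid using (Unique)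
open import Data.List.Relation.Unary.Unique.Setoid.Properties renaming (cartesianProductWith⁺ to Unique-cartesianProductWith⁺) using ()
open import Data.Nat as ℕ using (ℕ; zero; suc)
import Data.Nat.Properties as ℕₚ
open import Data.Product using (∃; _×_; _,_)
open import Data.Rational as ℚ using (ℚ; 0ℚ; 1ℚ; ½; ∣_∣; 1/_)
import Data.Rational.Properties as ℚₚ
open import Data.Rational.Solver using (module +-*-Solver)
open import Level using (0ℓ)
open import Relation.Binary using (IsEquivalence; Setoid)
open import Relation.Binary.PropositionalEquality as ≡ using (_≡_; refl; sym; trans; cong; cong₂; subst)
open import Relation.Nullary using (does)
open import Relation.Nullary.Decidable using (¬?; _×-dec_)

-- The real numbers: Cauchy sequences of rationals, two of which are
-- equal as reals when their difference tends to 0. Proofs of the Cauchy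
-- property are abstract so that they are never unfolded when comparing
-- reals during type checking.

-- f m n → 0 as min (m , n) → ∞.
record TendsToZero (f : ℕ → ℕ → ℚ) : Set where
  constructor tendsToZero
  field
    small : ∀ ε → 0ℚ ℚ.< ε → ∃ λ N → ∀ m n → N ℕ.≤ m → N ℕ.≤ n → ∣ f m n ∣ ℚ.< ε
open TendsToZero public

record ℝ : Set where
  constructor mkℝ
  field
    seq    : ℕ → ℚ
    cauchy : TendsToZero (λ m n → seq m ℚ.- seq n)
open ℝ public

infix 4 _≃_
record _≃_ (x y : ℝ) : Set where
  constructor mk≃
  field
    difference→0 : TendsToZero (λ n _ → seq x n ℚ.- seq y n)
open _≃_ public

private
  Bounded : (ℕ → ℚ) → Set
  Bounded x = ∃ λ B → 0ℚ ℚ.< B × ∃ λ N → ∀ n → N ℕ.≤ n → ∣ x n ∣ ℚ.≤ B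

  abstract
    0<½* : ∀ {ε} → 0ℚ ℚ.< ε → 0ℚ ℚ.< ½ ℚ.* ε
    0<½* {ε} 0<ε = ℚₚ.positive⁻¹ (½ ℚ.* ε) {{ℚₚ.pos*pos⇒pos ½ ε {{ℚ.positive 0<ε}}}}

    ½+½ : ∀ ε → ½ ℚ.* ε ℚ.+ ½ ℚ.* ε ≡ ε
    ½+½ ε = trans (sym (ℚₚ.*-distribʳ-+ ε ½ ½)) (ℚₚ.*-identityˡ ε)

    →0-resp : ∀ {f g} → (∀ m n → f m n ≡ g m n) → TendsToZero f → TendsToZero g
    small (→0-resp f≡g f→0) ε 0<ε with small f→0 ε 0<ε
    ... | N , h = N , λ m n N≤m N≤n → subst (λ q → ∣ q ∣ ℚ.< ε) (f≡g m n) (h m n N≤m N≤n)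

    →0-zero : TendsToZero (λ _ _ → 0ℚ)
    small →0-zero ε 0<ε = 0 , λ _ _ _ _ → 0<ε

    →0-neg : ∀ {f} → TendsToZero f → TendsToZero (λ m n → ℚ.- f m n)
    small (→0-neg {f} f→0) ε 0<ε with small f→0 ε 0<ε
    ... | N , h = N , λ m n N≤m N≤n → subst (ℚ._< ε) (sym (ℚₚ.∣-p∣≡∣p∣ (f m n))) (h m n N≤m N≤n)

    →0-+ : ∀ {f g} → TendsToZero f → TendsToZero g → TendsToZero (λ m n → f m n ℚ.+ g m n)
    small (→0-+ {f} {g} f→0 g→0) ε 0<ε with small f→0 (½ ℚ.* ε) (0<½* 0<ε) | small g→0 (½ ℚ.* ε) (0<½* 0<ε)
    ... | M , h | N , k = M ℕ.⊔ N , λ m n ≤m ≤n → ℚₚ.≤-<-trans (ℚₚ.∣p+q∣≤∣p∣+∣q∣ (f m n) (g m n))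
          (subst (∣ f m n ∣ ℚ.+ ∣ g m n ∣ ℚ.<_) (½+½ ε)
            (ℚₚ.+-mono-< (h m n (ℕₚ.m⊔n≤o⇒m≤o M N ≤m) (ℕₚ.m⊔n≤o⇒m≤o M N ≤n))
                         (k m n (ℕₚ.m⊔n≤o⇒n≤o M N ≤m) (ℕₚ.m⊔n≤o⇒n≤o M N ≤n))))

    cauchy⇒bounded : ∀ x → Bounded (seq x)
    cauchy⇒bounded x with small (cauchy x) 1ℚ (ℚₚ.positive⁻¹ 1ℚ)
    ... | N , h = 1ℚ ℚ.+ ∣ seq x N ∣
                , ℚₚ.<-≤-trans (ℚₚ.positive⁻¹ 1ℚ) (subst (ℚ._≤ 1ℚ ℚ.+ ∣ seq x N ∣) (ℚₚ.+-identityʳ 1ℚ) (ℚₚ.+-monoʳ-≤ 1ℚ (ℚₚ.0≤∣p∣ (seq x N))))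
                , N , λ n N≤n → ℚₚ.≤-trans
                    (subst (λ q → ∣ q ∣ ℚ.≤ ∣ seq x n ℚ.- seq x N ∣ ℚ.+ ∣ seq x N ∣)
                      (solve 2 (λ a b → (a :- b) :+ b := a) refl (seq x n) (seq x N))
                      (ℚₚ.∣p+q∣≤∣p∣+∣q∣ (seq x n ℚ.- seq x N) (seq x N)))
                    (ℚₚ.+-monoˡ-≤ ∣ seq x N ∣ (ℚₚ.<⇒≤ (h n N N≤n ℕₚ.≤-refl)))
      where open +-*-Solver

    divide : ∀ B ε → 0ℚ ℚ.< B → 0ℚ ℚ.< ε → ∃ λ δ → 0ℚ ℚ.< δ × B ℚ.* δ ≡ ε
    divide B ε 0<B 0<ε = 1/B*ε (ℚ.positive 0<B) (ℚ.positive 0<ε)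
      where
      1/B*ε : ℚ.Positive B → ℚ.Positive ε → ∃ λ δ → 0ℚ ℚ.< δ × B ℚ.* δ ≡ ε
      1/B*ε B⁺ ε⁺ = r ℚ.* ε
                  , ℚₚ.positive⁻¹ (r ℚ.* ε) {{ℚₚ.pos*pos⇒pos r {{ℚₚ.1/pos⇒pos B {{B⁺}}}} ε {{ε⁺}}}}
                  , trans (sym (ℚₚ.*-assoc B r ε))
                      (trans (cong (ℚ._* ε) (ℚₚ.*-inverseʳ B {{ℚₚ.pos⇒nonZero B {{B⁺}}}})) (ℚₚ.*-identityˡ ε))
        where
        r : ℚ
        r = (1/ B) {{ℚₚ.pos⇒nonZero B {{B⁺}}}}

    →0-* : ∀ {f g} → Bounded g → TendsToZero f → TendsToZero (λ m n → g m ℚ.* f m n)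
    small (→0-* {f} {g} (B , 0<B , M , b) f→0) ε 0<ε with divide B ε 0<B 0<ε
    ... | δ , 0<δ , B*δ≡ε with small f→0 δ 0<δ
    ... | N , h = M ℕ.⊔ N , λ m n ≤m ≤n →
        subst (ℚ._< ε) (sym (ℚₚ.∣p*q∣≡∣p∣*∣q∣ (g m) (f m n)))
          (ℚₚ.≤-<-trans
            (ℚₚ.*-monoʳ-≤-nonNeg ∣ f m n ∣ {{ℚₚ.∣-∣-nonNeg (f m n)}} (b m (ℕₚ.m⊔n≤o⇒m≤o M N ≤m)))
            (subst (B ℚ.* ∣ f m n ∣ ℚ.<_) B*δ≡ε
              (ℚₚ.*-monoʳ-<-pos B {{ℚ.positive 0<B}} (h m n (ℕₚ.m⊔n≤o⇒n≤o M N ≤m) (ℕₚ.m⊔n≤o⇒n≤o M N ≤n)))))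

    →0-flip : ∀ {f} → TendsToZero f → TendsToZero (λ m n → f n m)
    small (→0-flip f→0) ε 0<ε with small f→0 ε 0<ε
    ... | N , h = N , λ m n N≤m N≤n → h n m N≤n N≤m

private
  abstract
    fromℚ-cauchy : ∀ q → TendsToZero (λ _ _ → q ℚ.- q)
    fromℚ-cauchy q = →0-resp (λ _ _ → sym (ℚₚ.+-inverseʳ q)) →0-zero

    +ᵣ-cauchy : ∀ x y → TendsToZero (λ m n → (seq x m ℚ.+ seq y m) ℚ.- (seq x n ℚ.+ seq y n))
    +ᵣ-cauchy x y =
      →0-resp (λ m n → solve 4 (λ a b c d → (a :- b) :+ (c :- d) := (a :+ c) :- (b :+ d)) refl
                         (seq x m) (seq x n) (seq y m) (seq y n))
        (→0-+ (cauchy x) (cauchy y))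
      where open +-*-Solver

    -ᵣ-cauchy : ∀ x → TendsToZero (λ m n → (ℚ.- seq x m) ℚ.- (ℚ.- seq x n))
    -ᵣ-cauchy x =
      →0-resp (λ m n → solve 2 (λ a b → :- (a :- b) := (:- a) :- (:- b)) refl (seq x m) (seq x n))
        (→0-neg (cauchy x))
      where open +-*-Solver

    *ᵣ-cauchy : ∀ x y → TendsToZero (λ m n → (seq x m ℚ.* seq y m) ℚ.- (seq x n ℚ.* seq y n))
    *ᵣ-cauchy x y =
      →0-resp (λ m n → solve 4 (λ a b c d → a :* (c :- d) :+ (:- (d :* (b :- a))) := a :* c :- b :* d) refl
                         (seq x m) (seq x n) (seq y m) (seq y n))
        (→0-+ (→0-* (cauchy⇒bounded x) (cauchy y))
              (→0-neg (→0-flip (→0-* (cauchy⇒bounded y) (cauchy x)))))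
      where open +-*-Solver

fromℚ : ℚ → ℝ
fromℚ q = mkℝ (λ _ → q) (fromℚ-cauchy q)

infixl 6 _+ᵣ_
infixl 7 _*ᵣ_
infix  8 -ᵣ_

_+ᵣ_ : ℝ → ℝ → ℝ
x +ᵣ y = mkℝ (λ n → seq x n ℚ.+ seq y n) (+ᵣ-cauchy x y)

-ᵣ_ : ℝ → ℝ
-ᵣ x = mkℝ (λ n → ℚ.- seq x n) (-ᵣ-cauchy x)

_*ᵣ_ : ℝ → ℝ → ℝ
x *ᵣ y = mkℝ (λ n → seq x n ℚ.* seq y n) (*ᵣ-cauchy x y)

private
  pointwise : ∀ {x y} → (∀ n → seq x n ≡ seq y n) → x ≃ y
  pointwise {x} {y} x≡y = mk≃ (→0-resp (λ n _ → trans (sym (ℚₚ.+-inverseʳ (seq y n))) (cong (ℚ._- seq y n) (sym (x≡y n)))) →0-zero)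

  ≃-isEquivalence : IsEquivalence _≃_
  ≃-isEquivalence = record
    { refl  = pointwise (λ _ → refl)
    ; sym   = λ {x} {y} p → mk≃ (→0-resp (λ n _ → solve 2 (λ a b → :- (a :- b) := b :- a) refl (seq x n) (seq y n)) (→0-neg (difference→0 p)))
    ; trans = λ {x} {y} {z} p q → mk≃ (→0-resp (λ n _ → solve 3 (λ a b c → (a :- b) :+ (b :- c) := a :- c) refl (seq x n) (seq y n) (seq z n))
                                        (→0-+ (difference→0 p) (difference→0 q)))
    }
    where open +-*-Solver

  +ᵣ-cong : ∀ {x y u v} → x ≃ y → u ≃ v → x +ᵣ u ≃ y +ᵣ v
  +ᵣ-cong {x} {y} {u} {v} p q = mk≃
    (→0-resp (λ n _ → solve 4 (λ a b c d → (a :- b) :+ (c :- d) := (a :+ c) :- (b :+ d)) refl (seq x n) (seq y n) (seq u n) (seq v n))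
      (→0-+ (difference→0 p) (difference→0 q)))
    where open +-*-Solver

  -ᵣ-cong : ∀ {x y} → x ≃ y → -ᵣ x ≃ -ᵣ y
  -ᵣ-cong {x} {y} p = mk≃
    (→0-resp (λ n _ → solve 2 (λ a b → :- (a :- b) := (:- a) :- (:- b)) refl (seq x n) (seq y n))
      (→0-neg (difference→0 p)))
    where open +-*-Solver

  *ᵣ-cong : ∀ {x y u v} → x ≃ y → u ≃ v → x *ᵣ u ≃ y *ᵣ v
  *ᵣ-cong {x} {y} {u} {v} p q = mk≃
    (→0-resp (λ n _ → solve 4 (λ a b c d → a :* (c :- d) :+ d :* (a :- b) := a :* c :- b :* d) refl (seq x n) (seq y n) (seq u n) (seq v n))
      (→0-+ (→0-* (cauchy⇒bounded x) (difference→0 q)) (→0-* (cauchy⇒bounded v) (difference→0 p))))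
    where open +-*-Solver

  +ᵣ-assoc : ∀ x y z → (x +ᵣ y) +ᵣ z ≃ x +ᵣ (y +ᵣ z)
  +ᵣ-assoc x y z = pointwise (λ n → ℚₚ.+-assoc (seq x n) (seq y n) (seq z n))

  +ᵣ-comm : ∀ x y → x +ᵣ y ≃ y +ᵣ x
  +ᵣ-comm x y = pointwise (λ n → ℚₚ.+-comm (seq x n) (seq y n))

  +ᵣ-identityˡ : ∀ x → fromℚ 0ℚ +ᵣ x ≃ x
  +ᵣ-identityˡ x = pointwise (λ n → ℚₚ.+-identityˡ (seq x n))

  +ᵣ-identityʳ : ∀ x → x +ᵣ fromℚ 0ℚ ≃ x
  +ᵣ-identityʳ x = pointwise (λ n → ℚₚ.+-identityʳ (seq x n))

  +ᵣ-inverseˡ : ∀ x → (-ᵣ x) +ᵣ x ≃ fromℚ 0ℚ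
  +ᵣ-inverseˡ x = pointwise (λ n → ℚₚ.+-inverseˡ (seq x n))

  +ᵣ-inverseʳ : ∀ x → x +ᵣ (-ᵣ x) ≃ fromℚ 0ℚ
  +ᵣ-inverseʳ x = pointwise (λ n → ℚₚ.+-inverseʳ (seq x n))

  *ᵣ-assoc : ∀ x y z → (x *ᵣ y) *ᵣ z ≃ x *ᵣ (y *ᵣ z)
  *ᵣ-assoc x y z = pointwise (λ n → ℚₚ.*-assoc (seq x n) (seq y n) (seq z n))

  *ᵣ-comm : ∀ x y → x *ᵣ y ≃ y *ᵣ x
  *ᵣ-comm x y = pointwise (λ n → ℚₚ.*-comm (seq x n) (seq y n))

  *ᵣ-identityˡ : ∀ x → fromℚ 1ℚ *ᵣ x ≃ x
  *ᵣ-identityˡ x = pointwise (λ n → ℚₚ.*-identityˡ (seq x n))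

  *ᵣ-identityʳ : ∀ x → x *ᵣ fromℚ 1ℚ ≃ x
  *ᵣ-identityʳ x = pointwise (λ n → ℚₚ.*-identityʳ (seq x n))

  *ᵣ-distribˡ-+ᵣ : ∀ x y z → x *ᵣ (y +ᵣ z) ≃ (x *ᵣ y) +ᵣ (x *ᵣ z)
  *ᵣ-distribˡ-+ᵣ x y z = pointwise (λ n → ℚₚ.*-distribˡ-+ (seq x n) (seq y n) (seq z n))

  *ᵣ-distribʳ-+ᵣ : ∀ x y z → (y +ᵣ z) *ᵣ x ≃ (y *ᵣ x) +ᵣ (z *ᵣ x)
  *ᵣ-distribʳ-+ᵣ x y z = pointwise (λ n → ℚₚ.*-distribʳ-+ (seq x n) (seq y n) (seq z n))

ℝ-isCommutativeRing : IsCommutativeRing _≃_ _+ᵣ_ _*ᵣ_ -ᵣ_ (fromℚ 0ℚ) (fromℚ 1ℚ)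
ℝ-isCommutativeRing = record
  { isRing = record
    { +-isAbelianGroup = record
      { isGroup = record
        { isMonoid = record
          { isSemigroup = record
            { isMagma = record { isEquivalence = ≃-isEquivalence ; ∙-cong = +ᵣ-cong }
            ; assoc   = +ᵣ-assoc
            }
          ; identity = +ᵣ-identityˡ , +ᵣ-identityʳ
          }
        ; inverse = +ᵣ-inverseˡ , +ᵣ-inverseʳ
        ; ⁻¹-cong = -ᵣ-cong
        }
      ; comm = +ᵣ-comm
      }
    ; *-cong     = *ᵣ-cong
    ; *-assoc    = *ᵣ-assoc
    ; *-identity = *ᵣ-identityˡ , *ᵣ-identityʳ
    ; distrib    = *ᵣ-distribˡ-+ᵣ , *ᵣ-distribʳ-+ᵣ
    }
  ; *-comm = *ᵣ-comm
  }

ℝ-commutativeRing : CommutativeRing 0ℓ 0ℓ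
ℝ-commutativeRing = record { isCommutativeRing = ℝ-isCommutativeRing }

record SimpleGraph (n : ℕ) : Set where
  field
    adj        : Fin n → Fin n → Bool
    adj-sym    : ∀ u v → adj u v ≡ adj v u
    adj-irrefl : ∀ v → adj v v ≡ false
open SimpleGraph public

-- Each undirected edge {s , t} is listed once, as the pair with s < t.
edges : ∀ {n} → SimpleGraph n → List (Fin n × Fin n)
edges {n} G = filter (λ (s , t) → (s <? t) ×-dec T? (adj G s t)) (cartesianProduct (allFin n) (allFin n))

degree : ∀ {n} → SimpleGraph n → Fin n → ℕ
degree {n} G v = length (filter (λ u → T? (adj G v u)) (allFin n))

joins : ∀ {n} → Fin n × Fin n → Fin n → Fin n → Bool
joins (s , t) u v = (does (u ≟ s) ∧ does (v ≟ t)) ∨ (does (u ≟ t) ∧ does (v ≟ s))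

infixl 6 _−_
_−_ : ∀ {n} → SimpleGraph n → Fin n × Fin n → SimpleGraph n
G − e@(s , t) = record
  { adj        = λ u v → adj G u v ∧ not (joins e u v)
  ; adj-sym    = λ u v → cong₂ (λ a b → a ∧ not b) (adj-sym G u v)
                   (trans (∨-comm (does (u ≟ s) ∧ does (v ≟ t)) _)
                          (cong₂ _∨_ (∧-comm (does (u ≟ t)) _) (∧-comm (does (u ≟ s)) _)))
  ; adj-irrefl = λ v → cong (_∧ not (joins e v v)) (adj-irrefl G v)
  }

permutations : ∀ n → List (Permutation′ n)
permutations zero    = idₚ ∷ []
permutations (suc n) = cartesianProductWith (insert zero) (allFin (suc n)) (permutations n)

permutationSetoid : ℕ → Setoid 0ℓ 0ℓ
permutationSetoid n = record
  { Carrier = Permutation′ n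
  ; _≈_     = λ α β → ∀ i → α ⟨$⟩ʳ i ≡ β ⟨$⟩ʳ i
  ; isEquivalence = record
    { refl = λ _ → refl ; sym = λ p i → sym (p i) ; trans = λ p q i → trans (p i) (q i) }
  }

-- The two facts below say that the list contains each permutation
-- exactly once.
permutations-complete : ∀ n (α : Permutation′ n) → Any (Setoid._≈_ (permutationSetoid n) α) (permutations n)
permutations-complete zero    α = here (λ ())
permutations-complete (suc n) α = cartesianProductWith⁺ (insert zero) step (∈-allFin (α ⟨$⟩ʳ zero)) (permutations-complete n (remove zero α))
  where
  step : ∀ {j π} → α ⟨$⟩ʳ zero ≡ j → (∀ i → remove zero α ⟨$⟩ʳ i ≡ π ⟨$⟩ʳ i) → ∀ i → α ⟨$⟩ʳ i ≡ insert zero j π ⟨$⟩ʳ i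
  step refl q zero    = refl
  step refl q (suc i) = trans (punchIn-permute α zero i) (cong (Fin.punchIn (α ⟨$⟩ʳ zero)) (q i))

permutations-unique : ∀ n → Unique (permutationSetoid n) (permutations n)
permutations-unique zero    = [] ∷ []
permutations-unique (suc n) =
  Unique-cartesianProductWith⁺ (≡.setoid (Fin (suc n))) (permutationSetoid n) (permutationSetoid (suc n))
    (insert zero) (λ {j} {k} {π} {ρ} → injective {j} {k} {π} {ρ}) (allFin⁺ (suc n)) (permutations-unique n)
  where
  injective : ∀ {j k π ρ} → (∀ i → insert zero j π ⟨$⟩ʳ i ≡ insert zero k ρ ⟨$⟩ʳ i) → j ≡ k × (∀ i → π ⟨$⟩ʳ i ≡ ρ ⟨$⟩ʳ i)
  injective {j} p with p zero
  ... | refl = refl , λ i → punchIn-injective j _ _ (p (suc i))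

inversions : ∀ {n} → Permutation′ n → ℕ
inversions {n} α = length (filter (λ (i , j) → (i <? j) ×-dec (α ⟨$⟩ʳ j <? α ⟨$⟩ʳ i)) (cartesianProduct (allFin n) (allFin n)))

Matrix : ∀ {a} → Set a → ℕ → Set a
Matrix A n = Fin n → Fin n → A

without : ∀ {n} → Fin n → Fin n → List (Fin n)
without {n} s t = filter (λ k → ¬? (k ≟ s) ×-dec ¬? (k ≟ t)) (allFin n)

-- M with rows s , t and columns s , t deleted: the remaining indices are
-- listed in increasing order.
delete : ∀ {a} {A : Set a} {n} → (s t : Fin n) → Matrix A n → Matrix A (length (without s t))
delete s t M i j = M (lookup (without s t) i) (lookup (without s t) j)

module MatrixFunctions {c ℓ} (R : RawRing c ℓ) where
  open RawRing R
  open RawSemiringDefinitions rawSemiring using (product; _^_) renaming (_×_ to _×ᵣ_)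

  fromℕ : ℕ → Carrier
  fromℕ k = k ×ᵣ 1#

  sumOver : ∀ {a} {A : Set a} → List A → (A → Carrier) → Carrier
  sumOver xs f = foldr _+_ 0# (map f xs)

  sign : ∀ {n} → Permutation′ n → Carrier
  sign α = (- 1#) ^ inversions α

  det : ∀ {n} → Matrix Carrier n → Carrier
  det {n} M = sumOver (permutations n) λ α → sign α * product (λ k → M k (α ⟨$⟩ʳ k))

  per : ∀ {n} → Matrix Carrier n → Carrier
  per {n} M = sumOver (permutations n) λ α → product (λ k → M k (α ⟨$⟩ʳ k))

  identityMatrix : ∀ {n} → Matrix Carrier n
  identityMatrix i j = if does (i ≟ j) then 1# else 0#

  degreeMatrix : ∀ {n} → SimpleGraph n → Matrix Carrier n
  degreeMatrix G i j = if does (i ≟ j) then fromℕ (degree G i) else 0#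

  adjacencyMatrix : ∀ {n} → SimpleGraph n → Matrix Carrier n
  adjacencyMatrix G i j = if adj G i j then 1# else 0#

-- Polynomials in one variable x over a ring, as lists of coefficients,
-- constant term first. Trailing zeros are allowed, so equality compares
-- coefficients. The derivative is the formal one.

module Polynomials {c ℓ} (R : RawRing c ℓ) where
  open RawRing R
  open RawSemiringDefinitions rawSemiring using () renaming (_×_ to _×ᵣ_)

  Poly : Set c
  Poly = List Carrier

  coeff : Poly → ℕ → Carrier
  coeff []      k       = 0#
  coeff (a ∷ p) zero    = a
  coeff (a ∷ p) (suc k) = coeff p k

  infix 4 _≈ₚ_
  record _≈ₚ_ (p q : Poly) : Set ℓ where
    constructor mk≈ₚ
    field
      coeff-≈ : ∀ k → coeff p k ≈ coeff q k
  open _≈ₚ_ public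

  const : Carrier → Poly
  const a = a ∷ []

  var : Poly
  var = 0# ∷ 1# ∷ []

  infixl 6 _+ₚ_
  _+ₚ_ : Poly → Poly → Poly
  []      +ₚ q       = q
  (a ∷ p) +ₚ []      = a ∷ p
  (a ∷ p) +ₚ (b ∷ q) = (a + b) ∷ (p +ₚ q)

  infix 8 -ₚ_
  -ₚ_ : Poly → Poly
  -ₚ p = map (λ a → - a) p

  infixl 7 _*ₚ_
  _*ₚ_ : Poly → Poly → Poly
  []      *ₚ q = []
  (a ∷ p) *ₚ q = map (a *_) q +ₚ (0# ∷ (p *ₚ q))

  -- aₖ , aₖ₊₁ , …  ↦  k aₖ , (k + 1) aₖ₊₁ , …
  scaleByIndexFrom : ℕ → Poly → Poly
  scaleByIndexFrom k []      = []
  scaleByIndexFrom k (a ∷ p) = (k ×ᵣ a) ∷ scaleByIndexFrom (suc k) p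

  derivative : Poly → Poly
  derivative []      = []
  derivative (_ ∷ p) = scaleByIndexFrom 1 p

  rawRing : RawRing c ℓ
  rawRing = record
    { Carrier = Poly
    ; _≈_     = _≈ₚ_
    ; _+_     = _+ₚ_
    ; _*_     = _*ₚ_
    ; -_      = -ₚ_
    ; 0#      = []
    ; 1#      = const 1#
    }

module GraphPolynomials {c ℓ} (R : RawRing c ℓ) where
  open RawRing R using (Carrier)
  open Polynomials R public
  open MatrixFunctions rawRing public

  infixl 6 _-ₚ_
  _-ₚ_ : Poly → Poly → Poly
  p -ₚ q = p +ₚ (-ₚ q)

  -- x Iₙ − β D − γ A
  graphMatrix : ∀ {n} → Carrier → Carrier → SimpleGraph n → Matrix Poly n
  graphMatrix β γ G i j =
    var *ₚ identityMatrix i j -ₚ const β *ₚ degreeMatrix G i j -ₚ const γ *ₚ adjacencyMatrix G i j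

  τ₁ : ∀ {n} → Carrier → Carrier → SimpleGraph n → Poly
  τ₁ β γ G = det (graphMatrix β γ G)

  τ₂ : ∀ {n} → Carrier → Carrier → SimpleGraph n → Poly
  τ₂ β γ G = per (graphMatrix β γ G)

open GraphPolynomials (CommutativeRing.rawRing ℝ-commutativeRing) public

{-# OPTIONS --safe #-}
module Submission where

-- Write M = x I − β D − γ A. Deleting the edge e = {s , t} adds to M the
-- matrix Nₑ with entries β at (s , s), (t , t) and γ at (s , t), (t , s).
-- Expand det (M + Nₑ) in Nₑ: the terms of degree at least 2 come from the
-- permutations fixing s and t (β²) or swapping them (−γ²), and together give
-- (β² − γ²) det (M with s , t deleted). The linear terms, summed over all
-- edges, are the derivative of det at M in the direction Σₑ Nₑ = β D + γ A,
-- which equals x I − M. In the direction M this derivative is n det M, and in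
-- the direction x I it is θ (det M), where θ = x d/dx is a derivation with
-- θ M = x I. The permanent differs only in the sign of the swap, so both cases
-- are treated at once by giving α the weight η ^ (inversions of α) with η² = 1.

open import Algebra.Bundles using (CommutativeRing; RawRing)
import Algebra.Definitions.RawSemiring as RawSemiringDefinitions
import Algebra.Properties.CommutativeMonoid.Sum as CommutativeMonoidSum
import Algebra.Properties.Ring as RingProperties
import Algebra.Properties.Semiring.Exp as SemiringExp
import Algebra.Properties.Semiring.Mult as SemiringMult
import Algebra.Solver.Ring.NaturalCoefficients.Default as SemiringSolver
open import Data.Bool using (Bool; true; false; T; T?; _∧_; _∨_; not; if_then_else_)
open import Data.Bool.Properties using (∨-identityʳ)
open import Data.Fin using (Fin; zero; suc; toℕ; punchIn; punchOut; _<_; _<?_; cast)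
open import Data.Fin.Permutation using (Permutation′; _⟨$⟩ʳ_; insert; remove; insert-punchIn; insert-remove) renaming (_≈_ to _≈ₚₑᵣₘ_)
open import Data.Fin.Properties using (_≟_; <⇒≢; all?; punchIn-injective; punchInᵢ≢i; punchIn-punchOut; cast-is-id)
open import Data.List using (List; []; _∷_; _++_; map; length; filter; allFin; tabulate; lookup; cartesianProduct; cartesianProductWith)
open import Data.List.Membership.Propositional.Properties using (∈-allFin)
open import Data.List.Properties using (filter-++; length-++; filter-all; filter-reject; length-tabulate; lookup-tabulate)
open import Data.List.Relation.Unary.All as All using (All; []; _∷_)
import Data.List.Relation.Unary.All.Properties as Allₚ
open import Data.List.Relation.Unary.AllPairs using ([]; _∷_)
open import Data.List.Relation.Unary.Any using (Any; here; there)
open import Data.List.Relation.Unary.Any.Properties using (cartesianProductWith⁺)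
open import Data.List.Relation.Unary.Unique.Propositional.Properties using (allFin⁺)
open import Data.List.Relation.Unary.Unique.Setoid using (Unique)
import Data.List.Relation.Unary.Unique.Setoid.Properties as Uniqueₚ
open import Data.Nat as ℕ using (ℕ; zero; suc)
import Data.Nat.Properties as ℕₚ
open import Data.Product using (_×_; _,_)
open import Data.Rational using (0ℚ)
open import Function using (_∘_)
open import Level using (_⊔_)
open import Relation.Binary using (Setoid; Decidable)
open import Relation.Binary.PropositionalEquality as ≡ using (_≡_; _≢_)
import Relation.Binary.Reasoning.Setoid as SetoidReasoning
open import Relation.Nullary using (¬_; yes; no; does; contradiction)
open import Relation.Nullary.Decidable using (dec-true; dec-false; ¬?; _×-dec_)
import Relation.Unary as U
open import Defs using (SimpleGraph; adj; adj-sym; adj-irrefl; edges; degree; joins; _−_; permutations; permutationSetoid; permutations-complete; permutations-unique; inversions; Matrix; without; delete; module MatrixFunctions; module Polynomials)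

-- The expansion in Nₑ stops at degree 2 because Nₑ has only two nonzero rows. The obstacle is the
-- quadratic term: `permutations` is built by inserting at row `zero`, whereas an edge singles out
-- two arbitrary rows. The permutations are therefore enumerated anew by their values at s and then
-- at t (`sumOver-permutations-insert`), as in a Laplace expansion along two rows. This needs a rule
-- for the weight of a permutation inserted at any position (`weight-insert`). The number of
-- inversions itself obeys no simple rule there, but its parity does, and η² = 1 is what lets the
-- weight see only the parity. In the factor m - n, the m counts the copies of det M contributed by
-- the edges, and the n is the degree in Euler's identity for the homogeneous function det.
-- Polynomials enter only at the end. Until then the argument runs over any commutative ring with a
-- derivation θ such that θ x = x and θ kills β, γ and η. Subtraction is mostly avoided by working
-- with M + (β D + γ A) = x I instead of M alone.

-- Index combinatorics: order, equality and removal of one or two indices.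

lt : ∀ {n} → Fin n → Fin n → Bool
lt a b = does (a <? b)

lt-irrefl : ∀ {n} (i : Fin n) → lt i i ≡ false
lt-irrefl zero    = ≡.refl
lt-irrefl (suc i) = lt-irrefl i

lt-punchIn : ∀ {n} (i : Fin (suc n)) a b → lt (punchIn i a) (punchIn i b) ≡ lt a b
lt-punchIn zero    a       b       = ≡.refl
lt-punchIn (suc i) zero    zero    = ≡.refl
lt-punchIn (suc i) zero    (suc b) = ≡.refl
lt-punchIn (suc i) (suc a) zero    = ≡.refl
lt-punchIn (suc i) (suc a) (suc b) = lt-punchIn i a b

lt-flip : ∀ {n} (i : Fin (suc n)) a → lt i (punchIn i a) ≡ not (lt (punchIn i a) i)
lt-flip zero    a       = ≡.refl
lt-flip (suc i) zero    = ≡.refl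
lt-flip (suc i) (suc a) = lt-flip i a

≟-sym : ∀ {n} (i j : Fin n) → does (i ≟ j) ≡ does (j ≟ i)
≟-sym zero    zero    = ≡.refl
≟-sym zero    (suc j) = ≡.refl
≟-sym (suc i) zero    = ≡.refl
≟-sym (suc i) (suc j) = ≟-sym i j

≟-punchIn : ∀ {n} (i : Fin (suc n)) a b → does (punchIn i a ≟ punchIn i b) ≡ does (a ≟ b)
≟-punchIn zero    a       b       = ≡.refl
≟-punchIn (suc i) zero    zero    = ≡.refl
≟-punchIn (suc i) zero    (suc b) = ≡.refl
≟-punchIn (suc i) (suc a) zero    = ≡.refl
≟-punchIn (suc i) (suc a) (suc b) = ≟-punchIn i a b

≗-punchIn : ∀ {a} {A : Set a} {n} (i : Fin (suc n)) {f g : Fin (suc n) → A} →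
            f i ≡ g i → (∀ k → f (punchIn i k) ≡ g (punchIn i k)) → ∀ k → f k ≡ g k
≗-punchIn i {f} {g} p q k with i ≟ k
... | yes ≡.refl = p
... | no  i≢k    = ≡.subst (λ l → f l ≡ g l) (punchIn-punchOut i≢k) (q (punchOut i≢k))

-- The position of `s` among the indices left when `punchIn s t` is deleted. It names the image of
-- the second row when the two rows are swapped.
unpunch : ∀ {n} → Fin (suc (suc n)) → Fin (suc n) → Fin (suc n)
unpunch         zero    t       = zero
unpunch         (suc s) zero    = s
unpunch {suc n} (suc s) (suc t) = suc (unpunch s t)

punchIn-unpunch : ∀ {n} (s : Fin (suc (suc n))) t → punchIn (punchIn s t) (unpunch s t) ≡ s
punchIn-unpunch         zero    t       = ≡.refl
punchIn-unpunch         (suc s) zero    = ≡.refl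
punchIn-unpunch {suc n} (suc s) (suc t) = ≡.cong suc (punchIn-unpunch s t)

-- Both sides enumerate in increasing order the indices other than `s` and `punchIn s t`; only the
-- order of the two deletions differs.
punchIn-punchIn-comm : ∀ {n} (s : Fin (suc (suc n))) t k → punchIn (punchIn s t) (punchIn (unpunch s t) k) ≡ punchIn s (punchIn t k)
punchIn-punchIn-comm         zero    t       k       = ≡.refl
punchIn-punchIn-comm         (suc s) zero    k       = ≡.refl
punchIn-punchIn-comm {suc n} (suc s) (suc t) zero    = ≡.refl
punchIn-punchIn-comm {suc n} (suc s) (suc t) (suc k) = ≡.cong suc (punchIn-punchIn-comm s t k)

insert-self : ∀ {n} i j (π : Permutation′ n) → insert i j π ⟨$⟩ʳ i ≡ j
insert-self i j π with i ≟ i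
... | yes _  = ≡.refl
... | no i≢i = contradiction ≡.refl i≢i

filter-tabulate-punchIn : ∀ {a p} {A : Set a} {P : U.Pred A p} (P? : U.Decidable P) {n} (f : Fin (suc n) → A) i →
  ¬ P (f i) → filter P? (tabulate f) ≡ filter P? (tabulate (f ∘ punchIn i))
filter-tabulate-punchIn P? f zero ¬Pf = filter-reject P? ¬Pf
filter-tabulate-punchIn P? {suc n} f (suc i) ¬Pf with P? (f zero)
... | yes Pf0 = ≡.cong (f zero ∷_) (filter-tabulate-punchIn P? (f ∘ suc) i ¬Pf)
... | no ¬Pf0 = filter-tabulate-punchIn P? (f ∘ suc) i ¬Pf

-- The filter rejects exactly the two indices that the two `punchIn` skip. This links the minors of
-- the statement to those that arise from inserting permutations.
without-punchIn : ∀ {n} (s : Fin (suc (suc n))) t → without s (punchIn s t) ≡ tabulate (punchIn s ∘ punchIn t)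
without-punchIn s t = ≡.trans (filter-tabulate-punchIn P? (λ i → i) s λ (s≢s , _) → s≢s ≡.refl)
  (≡.trans (filter-tabulate-punchIn P? (punchIn s) t λ (_ , t≢t) → t≢t ≡.refl)
    (filter-all P? (Allₚ.tabulate⁺ λ k → punchInᵢ≢i s _ , punchInᵢ≢i t k ∘ punchIn-injective s _ _)))
  where
  P? : U.Decidable (λ k → ¬ k ≡ s × ¬ k ≡ punchIn s t)
  P? k = ¬? (k ≟ s) ×-dec ¬? (k ≟ punchIn s t)

-- Finite sums and re-enumeration of the symmetric group.

module Sums {c ℓ} (S : CommutativeRing c ℓ) where
  open CommutativeRing S
  open MatrixFunctions rawRing using (sumOver; fromℕ)
  open SemiringSolver commutativeSemiring using (solve; _:=_; _:+_)
  open SetoidReasoning setoid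

  ⟦_⟧ : Bool → Carrier
  ⟦ b ⟧ = if b then 1# else 0#

  module _ {a} {A : Set a} where

    sumOver-cong-All : ∀ {p} {P : A → Set p} {xs} {f g : A → Carrier} → All P xs → (∀ x → P x → f x ≈ g x) → sumOver xs f ≈ sumOver xs g
    sumOver-cong-All []         f≈g = refl
    sumOver-cong-All (px ∷ pxs) f≈g = +-cong (f≈g _ px) (sumOver-cong-All pxs f≈g)

    sumOver-cong : ∀ xs {f g : A → Carrier} → (∀ x → f x ≈ g x) → sumOver xs f ≈ sumOver xs g
    sumOver-cong []       f≈g = refl
    sumOver-cong (x ∷ xs) f≈g = +-cong (f≈g x) (sumOver-cong xs f≈g)

    sumOver-+ : ∀ xs (f g : A → Carrier) → sumOver xs (λ x → f x + g x) ≈ sumOver xs f + sumOver xs g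
    sumOver-+ []       f g = sym (+-identityˡ _)
    sumOver-+ (x ∷ xs) f g = trans (+-congˡ (sumOver-+ xs f g))
      (solve 4 (λ a b c d → (a :+ b) :+ (c :+ d) := (a :+ c) :+ (b :+ d)) refl _ _ _ _)

    sumOver-*ˡ : ∀ xs a (f : A → Carrier) → sumOver xs (λ x → a * f x) ≈ a * sumOver xs f
    sumOver-*ˡ []       a f = sym (zeroʳ a)
    sumOver-*ˡ (x ∷ xs) a f = trans (+-congˡ (sumOver-*ˡ xs a f)) (sym (distribˡ _ _ _))

    sumOver-0 : ∀ (xs : List A) → sumOver xs (λ _ → 0#) ≈ 0#
    sumOver-0 []       = refl
    sumOver-0 (x ∷ xs) = trans (+-identityˡ _) (sumOver-0 xs)

    sumOver-const : ∀ (xs : List A) y → sumOver xs (λ _ → y) ≈ fromℕ (length xs) * y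
    sumOver-const []       y = sym (zeroˡ y)
    sumOver-const (x ∷ xs) y = trans (+-cong (sym (*-identityˡ y)) (sumOver-const xs y)) (sym (distribʳ _ _ _))

    sumOver-++ : ∀ xs ys (f : A → Carrier) → sumOver (xs ++ ys) f ≈ sumOver xs f + sumOver ys f
    sumOver-++ []       ys f = sym (+-identityˡ _)
    sumOver-++ (x ∷ xs) ys f = trans (+-congˡ (sumOver-++ xs ys f)) (sym (+-assoc _ _ _))

    sumOver-filter : ∀ {p} {P : U.Pred A p} (P? : U.Decidable P) xs (f : A → Carrier) →
      sumOver (filter P? xs) f ≈ sumOver xs (λ x → ⟦ does (P? x) ⟧ * f x)
    sumOver-filter P? []       f = refl
    sumOver-filter P? (x ∷ xs) f with does (P? x)
    ... | true  = +-cong (sym (*-identityˡ _)) (sumOver-filter P? xs f)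
    ... | false = trans (sumOver-filter P? xs f) (sym (trans (+-congʳ (zeroˡ _)) (+-identityˡ _)))

  module _ {a b} {A : Set a} {B : Set b} where

    sumOver-map : ∀ (g : A → B) xs (f : B → Carrier) → sumOver (map g xs) f ≡ sumOver xs (f ∘ g)
    sumOver-map g []       f = ≡.refl
    sumOver-map g (x ∷ xs) f = ≡.cong (f (g x) +_) (sumOver-map g xs f)

    sumOver-swap : ∀ (xs : List A) (ys : List B) (f : A → B → Carrier) →
      sumOver xs (λ x → sumOver ys (f x)) ≈ sumOver ys (λ y → sumOver xs (λ x → f x y))
    sumOver-swap []       ys f = sym (sumOver-0 ys)
    sumOver-swap (x ∷ xs) ys f = trans (+-congˡ (sumOver-swap xs ys f)) (sym (sumOver-+ ys _ _))

  sumOver-cartesianProductWith : ∀ {a b c} {A : Set a} {B : Set b} {C : Set c} (g : A → B → C) xs ys (f : C → Carrier) →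
    sumOver (cartesianProductWith g xs ys) f ≈ sumOver xs (λ x → sumOver ys (λ y → f (g x y)))
  sumOver-cartesianProductWith g []       ys f = refl
  sumOver-cartesianProductWith g (x ∷ xs) ys f = trans (sumOver-++ (map (g x) ys) _ f)
    (+-cong (reflexive (sumOver-map (g x) ys f)) (sumOver-cartesianProductWith g xs ys f))

  module _ {a r} (A : Setoid a r) (_≈?_ : Decidable (Setoid._≈_ A)) where
    private module A = Setoid A

    sumOver-absent : ∀ {x xs} (f : A.Carrier → Carrier) → All (λ y → ¬ (x A.≈ y)) xs → sumOver xs (λ y → ⟦ does (x ≈? y) ⟧ * f y) ≈ 0#
    sumOver-absent             f []          = refl
    sumOver-absent {x} {y ∷ _} f (x≉y ∷ x≉ys) rewrite dec-false (x ≈? y) x≉y =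
      trans (+-cong (zeroˡ _) (sumOver-absent f x≉ys)) (+-identityˡ _)

    sumOver-δ : ∀ {x xs} {f : A.Carrier → Carrier} → (∀ {y z} → y A.≈ z → f y ≈ f z) → Unique A xs → Any (x A.≈_) xs →
      sumOver xs (λ y → ⟦ does (x ≈? y) ⟧ * f y) ≈ f x
    sumOver-δ {x} {y ∷ ys} {f} f-cong (y≉ys ∷ _) (here x≈y) rewrite dec-true (x ≈? y) x≈y = begin
      1# * f y + sumOver ys (λ z → ⟦ does (x ≈? z) ⟧ * f z) ≈⟨ +-cong (*-identityˡ _) (sumOver-absent f x≉ys) ⟩
      f y + 0#                                              ≈⟨ +-identityʳ _ ⟩
      f y                                                   ≈⟨ f-cong (A.sym x≈y) ⟩
      f x                                                   ∎
      where
      x≉ys : All (λ z → ¬ (x A.≈ z)) ys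
      x≉ys = All.map (λ y≉z x≈z → y≉z (A.trans (A.sym x≈y) x≈z)) y≉ys
    sumOver-δ {x} {y ∷ ys} {f} f-cong (y≉ys ∷ ys!) (there x∈ys) =
      trans (+-cong (trans (*-congʳ (reflexive (≡.cong ⟦_⟧ (dec-false (x ≈? y) (λ x≈y → absurd x≈y y≉ys x∈ys))))) (zeroˡ _))
                    (sumOver-δ f-cong ys! x∈ys))
            (+-identityˡ _)
      where
      absurd : ∀ {zs} → x A.≈ y → All (λ z → ¬ (y A.≈ z)) zs → ¬ Any (x A.≈_) zs
      absurd x≈y (y≉z ∷ _) (here x≈z) = y≉z (A.trans (A.sym x≈y) x≈z)
      absurd x≈y (_ ∷ ps) (there q)   = absurd x≈y ps q

    -- Double counting replaces a bijection between the lists: each `f x` is written as a sum over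
    -- `ys` weighted by the indicator of `x ≈ y`, and the two sums are exchanged.
    sumOver-unique : ∀ {xs ys} {f : A.Carrier → Carrier} → (∀ {y z} → y A.≈ z → f y ≈ f z) →
      Unique A xs → (∀ x → Any (x A.≈_) xs) → Unique A ys → (∀ x → Any (x A.≈_) ys) → sumOver xs f ≈ sumOver ys f
    sumOver-unique {xs} {ys} {f} f-cong xs! ∈xs ys! ∈ys = begin
      sumOver xs f
        ≈⟨ sumOver-cong xs (λ x → sumOver-δ f-cong ys! (∈ys x)) ⟨
      sumOver xs (λ x → sumOver ys (λ y → ⟦ does (x ≈? y) ⟧ * f y))
        ≈⟨ sumOver-swap xs ys _ ⟩
      sumOver ys (λ y → sumOver xs (λ x → ⟦ does (x ≈? y) ⟧ * f y))
        ≈⟨ sumOver-cong ys (λ y → sumOver-cong xs (λ x → *-congʳ (reflexive (≡.cong ⟦_⟧ (does-sym x y))))) ⟩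
      sumOver ys (λ y → sumOver xs (λ x → ⟦ does (y ≈? x) ⟧ * f y))
        ≈⟨ sumOver-cong ys (λ y → sumOver-δ (λ _ → refl) xs! (∈xs y)) ⟩
      sumOver ys f ∎
      where
      does-sym : ∀ x y → does (x ≈? y) ≡ does (y ≈? x)
      does-sym x y with y ≈? x
      ... | yes y≈x = dec-true (x ≈? y) (A.sym y≈x)
      ... | no  y≉x = dec-false (x ≈? y) (λ x≈y → y≉x (A.sym x≈y))

  sumOver-allFin-δ : ∀ {n} (i : Fin n) (f : Fin n → Carrier) → sumOver (allFin n) (λ j → ⟦ does (i ≟ j) ⟧ * f j) ≈ f i
  sumOver-allFin-δ i f = sumOver-δ (≡.setoid _) _≟_ (λ { ≡.refl → refl }) (allFin⁺ _) (∈-allFin i)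

  -- Expansion along an arbitrary row `i`: inserting at `i` also yields every permutation exactly
  -- once. The two lists agree only up to order and pointwise equality, whence the congruence
  -- condition on `f`.
  sumOver-permutations-insert : ∀ {n} (i : Fin (suc n)) {f : Permutation′ (suc n) → Carrier} → (∀ {α β} → α ≈ₚₑᵣₘ β → f α ≈ f β) →
    sumOver (permutations (suc n)) f ≈ sumOver (allFin (suc n)) (λ j → sumOver (permutations n) (λ π → f (insert i j π)))
  sumOver-permutations-insert {n} i {f} f-cong = trans
    (sumOver-unique (permutationSetoid (suc n)) (λ α β → all? (λ k → (α ⟨$⟩ʳ k) ≟ (β ⟨$⟩ʳ k)))
      (λ {α} {β} → f-cong {α} {β}) (permutations-unique (suc n)) (permutations-complete (suc n)) unique complete)
    (sumOver-cartesianProductWith (insert i) (allFin (suc n)) (permutations n) f)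
    where
    complete : ∀ α → Any (α ≈ₚₑᵣₘ_) (cartesianProductWith (insert i) (allFin (suc n)) (permutations n))
    complete α = cartesianProductWith⁺ (insert i) step (∈-allFin (α ⟨$⟩ʳ i)) (permutations-complete n (remove i α))
      where
      step : ∀ {j π} → α ⟨$⟩ʳ i ≡ j → remove i α ≈ₚₑᵣₘ π → α ≈ₚₑᵣₘ insert i j π
      step {π = π} ≡.refl q = ≗-punchIn i (≡.sym (insert-self i _ π)) λ k → ≡.trans
        (≡.sym (insert-remove i α (punchIn i k)))
        (≡.trans (insert-punchIn i _ (remove i α) k) (≡.trans (≡.cong (punchIn _) (q k)) (≡.sym (insert-punchIn i _ π k))))

    injective : ∀ {j k π ρ} → insert i j π ≈ₚₑᵣₘ insert i k ρ → j ≡ k × π ≈ₚₑᵣₘ ρ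
    injective {j} {k} {π} {ρ} p with ≡.trans (≡.sym (insert-self i j π)) (≡.trans (p i) (insert-self i k ρ))
    ... | ≡.refl = ≡.refl , λ l → punchIn-injective j _ _
      (≡.trans (≡.sym (insert-punchIn i j π l)) (≡.trans (p (punchIn i l)) (insert-punchIn i j ρ l)))

    unique : Unique (permutationSetoid (suc n)) (cartesianProductWith (insert i) (allFin (suc n)) (permutations n))
    unique = Uniqueₚ.cartesianProductWith⁺ (≡.setoid _) (permutationSetoid n) (permutationSetoid (suc n))
      (insert i) (λ {j} {k} {π} {ρ} → injective {j} {k} {π} {ρ}) (allFin⁺ (suc n)) (permutations-unique n)

-- Products and their directional derivatives.

module Products {c ℓ} (S : CommutativeRing c ℓ) where
  open CommutativeRing S hiding (zero)
  open MatrixFunctions rawRing using (sumOver; fromℕ)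
  open Sums S
  open RawSemiringDefinitions (RawRing.rawSemiring rawRing) using (product)
  open CommutativeMonoidSum *-commutativeMonoid using () renaming (sum-remove to product-remove)
  open SemiringSolver commutativeSemiring using (solve; _:=_; _:+_; _:*_; con)
  open SetoidReasoning setoid

  product-cong : ∀ {n} {a b : Fin n → Carrier} → (∀ k → a k ≈ b k) → product a ≈ product b
  product-cong {zero}  p = refl
  product-cong {suc n} p = *-cong (p zero) (product-cong (p ∘ suc))

  -- The part of ∏ₖ (a k + b k) that is linear in b.
  ∂ : ∀ {n} → (Fin n → Carrier) → (Fin n → Carrier) → Carrier
  ∂ {zero}  a b = 0#
  ∂ {suc n} a b = b zero * product (a ∘ suc) + a zero * ∂ (a ∘ suc) (b ∘ suc)

  ∂-congʳ : ∀ {n} a {b b′ : Fin n → Carrier} → (∀ k → b k ≈ b′ k) → ∂ a b ≈ ∂ a b′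
  ∂-congʳ {zero}  a p = refl
  ∂-congʳ {suc n} a p = +-cong (*-congʳ (p zero)) (*-congˡ (∂-congʳ (a ∘ suc) (p ∘ suc)))

  ∂-zero : ∀ {n} a {b : Fin n → Carrier} → (∀ k → b k ≈ 0#) → ∂ a b ≈ 0#
  ∂-zero {zero}  a p = refl
  ∂-zero {suc n} a p = trans (+-cong (trans (*-congʳ (p zero)) (zeroˡ _)) (trans (*-congˡ (∂-zero (a ∘ suc) (p ∘ suc))) (zeroʳ _))) (+-identityˡ _)

  ∂-+ : ∀ {n} a (b b′ : Fin n → Carrier) → ∂ a (λ k → b k + b′ k) ≈ ∂ a b + ∂ a b′
  ∂-+ {zero}  a b b′ = sym (+-identityˡ _)
  ∂-+ {suc n} a b b′ = trans (+-congˡ (*-congˡ (∂-+ (a ∘ suc) (b ∘ suc) (b′ ∘ suc))))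
    (solve 6 (λ a b c d e f → (a :+ b) :* c :+ d :* (e :+ f) := (a :* c :+ d :* e) :+ (b :* c :+ d :* f)) refl _ _ _ _ _ _)

  ∂-sumOver : ∀ {n i} {I : Set i} (xs : List I) a (b : I → Fin n → Carrier) → ∂ a (λ k → sumOver xs (λ x → b x k)) ≈ sumOver xs (λ x → ∂ a (b x))
  ∂-sumOver []       a b = ∂-zero a (λ _ → refl)
  ∂-sumOver (x ∷ xs) a b = trans (∂-+ a (b x) _) (+-congˡ (∂-sumOver xs a b))

  -- Euler's identity: the product is homogeneous of degree `n`.
  ∂-diagonal : ∀ {n} (a : Fin n → Carrier) → ∂ a a ≈ fromℕ n * product a
  ∂-diagonal {zero}  a = sym (zeroˡ _)
  ∂-diagonal {suc n} a = trans (+-congˡ (*-congˡ (∂-diagonal (a ∘ suc))))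
    (solve 3 (λ a b c → a :* b :+ a :* (c :* b) := (con 1 :+ c) :* (a :* b)) refl _ _ _)

  -- The recursion defining `∂` peels off index `zero`, but `∂` is symmetric in the indices, so any
  -- index can be peeled off.
  ∂-remove : ∀ {n} i (a b : Fin (suc n) → Carrier) → ∂ a b ≈ b i * product (a ∘ punchIn i) + a i * ∂ (a ∘ punchIn i) (b ∘ punchIn i)
  ∂-remove         zero    a b = refl
  ∂-remove {suc n} (suc i) a b = trans
    (+-cong (*-congˡ (product-remove {i = i} (a ∘ suc))) (*-congˡ (∂-remove i (a ∘ suc) (b ∘ suc))))
    (solve 6 (λ a₀ b₀ a b p d → b₀ :* (a :* p) :+ a₀ :* (b :* p :+ a :* d) := b :* (a₀ :* p) :+ a :* (b₀ :* p :+ a₀ :* d)) refl _ _ _ _ _ _)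

  -- Since `b` lives on two positions, no term of degree 3 or more in `b` survives.
  product-+-two : ∀ {n} s (t : Fin (suc n)) (a b : Fin (suc (suc n)) → Carrier) → (∀ k → b (punchIn s (punchIn t k)) ≈ 0#) →
    product (λ k → a k + b k) ≈ product a + ∂ a b + (b s * b (punchIn s t)) * product (a ∘ punchIn s ∘ punchIn t)
  product-+-two s t a b b≈0 = begin
    product (λ k → a k + b k)
      ≈⟨ trans (product-remove {i = s} (λ k → a k + b k)) (*-congˡ (product-remove {i = t} (λ k → a (punchIn s k) + b (punchIn s k)))) ⟩
    (a s + b s) * ((a u + b u) * product (λ k → a (ρ k) + b (ρ k)))
      ≈⟨ *-congˡ (*-congˡ (product-cong (λ k → trans (+-congˡ (b≈0 k)) (+-identityʳ _)))) ⟩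
    (a s + b s) * ((a u + b u) * product (a ∘ ρ))
      -- The summand with `con 0` keeps a place for `∂` on the remaining positions, so that the
      -- middle term has the shape given by applying `∂-remove` twice.
      ≈⟨ solve 5 (λ x y x′ y′ p → (x :+ y) :* ((x′ :+ y′) :* p) := x :* (x′ :* p) :+ (y :* (x′ :* p) :+ x :* (y′ :* p :+ x′ :* con 0)) :+ (y :* y′) :* p) refl _ _ _ _ _ ⟩
    a s * (a u * product (a ∘ ρ)) + (b s * (a u * product (a ∘ ρ)) + a s * (b u * product (a ∘ ρ) + a u * 0#)) + (b s * b u) * product (a ∘ ρ)
      ≈⟨ +-congʳ (+-cong (trans (product-remove {i = s} a) (*-congˡ (product-remove {i = t} a′)))
           (trans (∂-remove s a b) (+-cong (*-congˡ (product-remove {i = t} a′))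
             (*-congˡ (trans (∂-remove t a′ (b ∘ punchIn s)) (+-congˡ (*-congˡ (∂-zero _ b≈0)))))))) ⟨
    product a + ∂ a b + (b s * b u) * product (a ∘ ρ) ∎
    where
    u = punchIn s t
    a′ = a ∘ punchIn s
    ρ = punchIn s ∘ punchIn t

-- Weighted immanants: the weight under insertion and the quadratic term of the expansion.

module Immanants {c ℓ} (S : CommutativeRing c ℓ) (η : CommutativeRing.Carrier S)
  (η*η≈1 : CommutativeRing._≈_ S (CommutativeRing._*_ S η η) (CommutativeRing.1# S)) where
  open CommutativeRing S hiding (zero)
  open MatrixFunctions rawRing using (sumOver; fromℕ)
  open Sums S
  open Products S
  open RawSemiringDefinitions (RawRing.rawSemiring rawRing) using (product; _^_)
  open SemiringExp semiring using (^-homo-*)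
  open CommutativeMonoidSum *-commutativeMonoid using ()
    renaming (sum-remove to product-remove; ∑-distrib-+ to product-*; sum-permute to product-permute; sum-replicate-zero to product-replicate-1)
  open SemiringSolver commutativeSemiring using (solve; _:=_; _:+_; _:*_; con)
  open SetoidReasoning setoid

  ⟪_⟫ : Bool → Carrier
  ⟪ b ⟫ = if b then η else 1#

  weight : ∀ {n} → Permutation′ n → Carrier
  weight α = η ^ inversions α

  immanant : ∀ {n} → Matrix Carrier n → Carrier
  immanant {n} M = sumOver (permutations n) λ α → weight α * product (λ k → M k (α ⟨$⟩ʳ k))

  infix 5 _along_
  _along_ : ∀ {n} → Matrix Carrier n → Permutation′ n → Fin n → Carrier
  (M along α) k = M k (α ⟨$⟩ʳ k)

  -- The part of immanant (M + N) that is linear in N.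
  ∂immanant : ∀ {n} → Matrix Carrier n → Matrix Carrier n → Carrier
  ∂immanant {n} M N = sumOver (permutations n) λ α → weight α * ∂ (M along α) (N along α)

  -- Turning a count in the exponent into one factor per candidate makes it possible to split off
  -- and permute indices by the laws of products.
  ^-length-filter-map : ∀ {a b p} {A : Set a} {B : Set b} {P : U.Pred B p} (P? : U.Decidable P) (h : A → B) {n} (g : Fin n → A) →
    η ^ length (filter P? (map h (tabulate g))) ≈ product (λ j → ⟪ does (P? (h (g j))) ⟫)
  ^-length-filter-map P? h {zero}  g = refl
  ^-length-filter-map P? h {suc n} g with does (P? (h (g zero)))
  ... | true  = *-congˡ (^-length-filter-map P? h (g ∘ suc))
  ... | false = trans (^-length-filter-map P? h (g ∘ suc)) (sym (*-identityˡ _))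

  ^-length-filter-cartesianProduct : ∀ {a b p} {A : Set a} {B : Set b} {P : U.Pred (A × B) p} (P? : U.Decidable P) {m n} (f : Fin m → A) (g : Fin n → B) →
    η ^ length (filter P? (cartesianProduct (tabulate f) (tabulate g))) ≈ product (λ i → product (λ j → ⟪ does (P? (f i , g j)) ⟫))
  ^-length-filter-cartesianProduct P? {zero}  f g = refl
  ^-length-filter-cartesianProduct P? {suc m} f g = begin
    η ^ length (filter P? (xs ++ ys))
      ≡⟨ ≡.cong (η ^_) (≡.trans (≡.cong length (filter-++ P? xs ys)) (length-++ (filter P? xs))) ⟩
    η ^ (length (filter P? xs) ℕ.+ length (filter P? ys))
      ≈⟨ ^-homo-* η (length (filter P? xs)) (length (filter P? ys)) ⟩
    η ^ length (filter P? xs) * η ^ length (filter P? ys)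
      ≈⟨ *-cong (^-length-filter-map P? (f zero ,_) g) (^-length-filter-cartesianProduct P? (f ∘ suc) g) ⟩
    product (λ i → product (λ j → ⟪ does (P? (f i , g j)) ⟫)) ∎
    where
    xs = map (f zero ,_) (tabulate g)
    ys = cartesianProduct (tabulate (f ∘ suc)) (tabulate g)

  inversionFactor : ∀ {n} → Permutation′ n → Fin n → Fin n → Carrier
  inversionFactor α a b = ⟪ lt a b ∧ lt (α ⟨$⟩ʳ b) (α ⟨$⟩ʳ a) ⟫

  weight-product : ∀ {n} (α : Permutation′ n) → weight α ≈ product (λ a → product (inversionFactor α a))
  weight-product α = ^-length-filter-cartesianProduct (λ (i , j) → (i <? j) ×-dec (α ⟨$⟩ʳ j <? α ⟨$⟩ʳ i)) (λ i → i) (λ i → i)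

  weight-cong : ∀ {n} {α β : Permutation′ n} → α ≈ₚₑᵣₘ β → weight α ≈ weight β
  weight-cong {α = α} {β} p = trans (weight-product α) (trans
    (product-cong (λ a → product-cong (λ b → reflexive (≡.cong₂ (λ u v → ⟪ lt a b ∧ lt u v ⟫) (p b) (p a)))))
    (sym (weight-product β)))

  -- Exactly `toℕ i` of the other indices lie below `i`.
  product-below : ∀ {n} (i : Fin (suc n)) → product (λ a → ⟪ lt (punchIn i a) i ⟫) ≈ η ^ toℕ i
  product-below {n}     zero    = product-replicate-1 n
  product-below {suc n} (suc i) = *-congˡ (product-below i)

  -- Modulo 2, the inversions of α = insert i j π at i are the indices
  -- below i plus the values below j: an index that is both below i and
  -- sent below j is not an inversion and is counted twice.
  weight-insert : ∀ {n} i j (π : Permutation′ n) → weight (insert i j π) ≈ (η ^ toℕ i * η ^ toℕ j) * weight π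
  weight-insert {n} i j π = begin
    weight α
      ≈⟨ weight-product α ⟩
    product (λ a → product (h a))
      ≈⟨ product-remove {i = i} (λ a → product (h a)) ⟩
    product (h i) * product (λ a → product (h (p a)))
      ≈⟨ *-cong (product-remove {i = i} (h i)) (trans (product-cong (λ a → product-remove {i = i} (h (p a)))) (product-* (λ a → h (p a) i) _)) ⟩
    (h i i * product (λ b → h i (p b))) * (product (λ a → h (p a) i) * product (λ a → product (λ b → h (p a) (p b))))
      ≈⟨ *-cong (trans (*-congʳ (reflexive hii)) (*-identityˡ _)) (*-congˡ (product-cong (λ a → product-cong (λ b → reflexive (hpp a b))))) ⟩
    product (λ b → h i (p b)) * (product (λ a → h (p a) i) * product (λ a → product (inversionFactor π a)))
      ≈⟨ trans (sym (*-assoc _ _ _)) (*-cong (sym (product-* (λ b → h i (p b)) _)) (sym (weight-product π))) ⟩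
    product (λ b → h i (p b) * h (p b) i) * weight π
      ≈⟨ *-congʳ (trans (product-cong cross) (product-* (λ b → ⟪ lt (p b) i ⟫) _)) ⟩
    (product (λ b → ⟪ lt (p b) i ⟫) * product (λ b → ⟪ lt (punchIn j (π ⟨$⟩ʳ b)) j ⟫)) * weight π
      -- With `b`, its image under `π` also runs over all indices, so the values below `j` are
      -- counted in the same way as the indices below `i`.
      ≈⟨ *-congʳ (*-cong (product-below i) (trans (sym (product-permute (λ b → ⟪ lt (punchIn j b) j ⟫) π)) (product-below j))) ⟩
    (η ^ toℕ i * η ^ toℕ j) * weight π ∎
    where
    α = insert i j π
    p = punchIn i
    h = inversionFactor α

    hii : h i i ≡ 1#
    hii rewrite lt-irrefl i = ≡.refl

    hpp : ∀ a b → h (p a) (p b) ≡ inversionFactor π a b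
    hpp a b rewrite insert-punchIn i j π a | insert-punchIn i j π b | lt-punchIn i a b | lt-punchIn j (π ⟨$⟩ʳ b) (π ⟨$⟩ʳ a) = ≡.refl

    xor : ∀ u v → ⟪ not u ∧ v ⟫ * ⟪ u ∧ not v ⟫ ≈ ⟪ u ⟫ * ⟪ v ⟫
    xor true  true  = trans (*-identityˡ _) (sym η*η≈1)
    xor true  false = *-comm _ _
    xor false true  = *-comm _ _
    xor false false = refl

    cross : ∀ b → h i (p b) * h (p b) i ≈ ⟪ lt (p b) i ⟫ * ⟪ lt (punchIn j (π ⟨$⟩ʳ b)) j ⟫
    cross b rewrite insert-self i j π | insert-punchIn i j π b | lt-flip i b | lt-flip j (π ⟨$⟩ʳ b) =
      xor (lt (p b) i) (lt (punchIn j (π ⟨$⟩ʳ b)) j)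

  ^-double : ∀ k → η ^ k * η ^ k ≈ 1#
  ^-double zero    = *-identityˡ _
  ^-double (suc k) = trans (solve 2 (λ a b → (a :* b) :* (a :* b) := (a :* a) :* (b :* b)) refl η (η ^ k))
    (trans (*-cong η*η≈1 (^-double k)) (*-identityˡ _))

  -- Exactly one of s , t loses 1 when the other is punched out.
  ^-unpunch : ∀ {n} (s : Fin (suc (suc n))) t →
    (η ^ toℕ s * η ^ toℕ (punchIn s t)) * (η ^ toℕ t * η ^ toℕ (unpunch s t)) ≈ η
  ^-unpunch zero t = trans (solve 2 (λ a b → (con 1 :* (a :* b)) :* (b :* con 1) := a :* (b :* b)) refl η (η ^ toℕ t))
    (trans (*-congˡ (^-double (toℕ t))) (*-identityʳ _))
  ^-unpunch (suc s) zero = trans (solve 2 (λ a b → ((a :* b) :* con 1) :* (con 1 :* b) := a :* (b :* b)) refl η (η ^ toℕ s))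
    (trans (*-congˡ (^-double (toℕ s))) (*-identityʳ _))
  ^-unpunch {suc n} (suc s) (suc t) = begin
    ((η * a) * (η * b)) * ((η * c′) * (η * d))
      ≈⟨ solve 5 (λ η a b c d → ((η :* a) :* (η :* b)) :* ((η :* c) :* (η :* d)) := ((η :* η) :* (η :* η)) :* ((a :* b) :* (c :* d))) refl η a b c′ d ⟩
    ((η * η) * (η * η)) * ((a * b) * (c′ * d))
      ≈⟨ *-cong (*-cong η*η≈1 η*η≈1) (^-unpunch s t) ⟩
    (1# * 1#) * η
      ≈⟨ solve 1 (λ η → (con 1 :* con 1) :* η := η) refl η ⟩
    η ∎
    where
    a = η ^ toℕ s
    b = η ^ toℕ (punchIn s t)
    c′ = η ^ toℕ t
    d = η ^ toℕ (unpunch s t)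

  immanant-cong : ∀ {n} {M N : Matrix Carrier n} → (∀ i j → M i j ≈ N i j) → immanant M ≈ immanant N
  immanant-cong {n} p = sumOver-cong (permutations n) λ α → *-congˡ (product-cong λ k → p k _)

  -- The size of a minor made by `delete` is the length of a filtered list, which equals the
  -- expected size only propositionally.
  immanant-cast : ∀ {m n} (eq : m ≡ n) {M : Matrix Carrier m} {N : Matrix Carrier n} →
    (∀ i j → M (cast (≡.sym eq) i) (cast (≡.sym eq) j) ≡ N i j) → immanant M ≈ immanant N
  immanant-cast ≡.refl {M} p = immanant-cong λ i j → trans
    (reflexive (≡.sym (≡.cong₂ M (cast-is-id ≡.refl i) (cast-is-id ≡.refl j)))) (reflexive (p i j))

  immanant-lookup : ∀ {m n} (M : Matrix Carrier m) (f : Fin n → Fin m) {xs} → xs ≡ tabulate f →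
    immanant (λ i j → M (lookup xs i) (lookup xs j)) ≈ immanant (λ i j → M (f i) (f j))
  immanant-lookup M f ≡.refl = immanant-cast (length-tabulate f) {λ i j → M (lookup (tabulate f) i) (lookup (tabulate f) j)}
    λ i j → ≡.cong₂ M (lookup-tabulate f i) (lookup-tabulate f j)

  immanant-delete : ∀ {n} s t (M : Matrix Carrier (suc (suc n))) →
    immanant (delete s (punchIn s t) M) ≈ immanant (λ i j → M (punchIn s (punchIn t i)) (punchIn s (punchIn t j)))
  immanant-delete s t M = immanant-lookup M _ (without-punchIn s t)

  insert-cong : ∀ {n} i j {π ρ : Permutation′ n} → π ≈ₚₑᵣₘ ρ → insert i j π ≈ₚₑᵣₘ insert i j ρ
  insert-cong i j {π} {ρ} p = ≗-punchIn i (≡.trans (insert-self i j π) (≡.sym (insert-self i j ρ))) λ k →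
    ≡.trans (insert-punchIn i j π k) (≡.trans (≡.cong (punchIn j) (p k)) (≡.sym (insert-punchIn i j ρ k)))

  -- Each nonzero row of the edge increment is supported on two columns; this is the expansion along
  -- such a row.
  sumOver-δ₂ : ∀ {n} (i k : Fin n) b c (h : Fin n → Carrier) →
    sumOver (allFin n) (λ j → (b * ⟦ does (i ≟ j) ⟧ + c * ⟦ does (k ≟ j) ⟧) * h j) ≈ b * h i + c * h k
  sumOver-δ₂ {n} i k b c h = begin
    sumOver (allFin n) (λ j → (b * ⟦ does (i ≟ j) ⟧ + c * ⟦ does (k ≟ j) ⟧) * h j)
      ≈⟨ sumOver-cong (allFin n) (λ j → solve 5 (λ b u c v h → (b :* u :+ c :* v) :* h := b :* (u :* h) :+ c :* (v :* h)) refl b _ c _ (h j)) ⟩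
    sumOver (allFin n) (λ j → b * (⟦ does (i ≟ j) ⟧ * h j) + c * (⟦ does (k ≟ j) ⟧ * h j))
      ≈⟨ trans (sumOver-+ (allFin n) _ _) (+-cong (sumOver-*ˡ (allFin n) b _) (sumOver-*ˡ (allFin n) c _)) ⟩
    b * sumOver (allFin n) (λ j → ⟦ does (i ≟ j) ⟧ * h j) + c * sumOver (allFin n) (λ j → ⟦ does (k ≟ j) ⟧ * h j)
      ≈⟨ +-cong (*-congˡ (sumOver-allFin-δ i h)) (*-congˡ (sumOver-allFin-δ k h)) ⟩
    b * h i + c * h k ∎

  -- The endpoints are given as `s` and `punchIn s t`: distinctness is then built in, and two
  -- `punchIn` enumerate all other rows.
  module _ {n} (β γ : Carrier) (M N : Matrix Carrier (suc (suc n))) (s : Fin (suc (suc n))) (t : Fin (suc n))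
    (N-s : ∀ j → N s j ≈ β * ⟦ does (s ≟ j) ⟧ + γ * ⟦ does (punchIn s t ≟ j) ⟧)
    (N-t : ∀ j → N (punchIn s t) j ≈ β * ⟦ does (punchIn s t ≟ j) ⟧ + γ * ⟦ does (s ≟ j) ⟧)
    (N-0 : ∀ k j → N (punchIn s (punchIn t k)) j ≈ 0#)
    where
    private
      u = punchIn s t
      s′ = unpunch s t
      ρ = punchIn s ∘ punchIn t
      e : ∀ {m} → Fin m → Carrier
      e i = η ^ toℕ i

      Mρ : Matrix Carrier n
      Mρ i j = M (ρ i) (ρ j)

      -- The contribution of one permutation to the part quadratic in `N`.
      f : Permutation′ (suc (suc n)) → Carrier
      f α = weight α * ((N s (α ⟨$⟩ʳ s) * N u (α ⟨$⟩ʳ u)) * product (λ k → M (ρ k) (α ⟨$⟩ʳ ρ k)))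

      f-cong : ∀ {α β} → α ≈ₚₑᵣₘ β → f α ≈ f β
      f-cong {α} {β} p = *-cong (weight-cong {α = α} {β} p)
        (*-cong (reflexive (≡.cong₂ (λ i j → N s i * N u j) (p s) (p u)))
                (product-cong λ k → reflexive (≡.cong (M (ρ k)) (p (ρ k)))))

      -- The signed complementary minor of the Laplace expansion in which row `s` takes column `j`
      -- and row `u` takes column `punchIn j l`.
      K : Fin (suc (suc n)) → Fin (suc n) → Carrier
      K j l = ((e s * e j) * (e t * e l)) * immanant (λ i k → M (ρ i) (punchIn j (punchIn l k)))

      H : Fin (suc (suc n)) → Carrier
      H j = sumOver (allFin (suc n)) (λ l → N u (punchIn j l) * K j l)

      f-insert : ∀ j l π → f (insert s j (insert t l π)) ≈
        ((N s j * N u (punchIn j l)) * ((e s * e j) * (e t * e l))) * (weight π * product (λ k → M (ρ k) (punchIn j (punchIn l (π ⟨$⟩ʳ k)))))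
      f-insert j l π = trans
        (*-cong (trans (weight-insert s j _) (*-congˡ (weight-insert t l π)))
          (*-cong (reflexive (≡.cong₂ (λ a b → N s a * N u b) (insert-self s j (insert t l π))
                    (≡.trans (insert-punchIn s j _ t) (≡.cong (punchIn j) (insert-self t l π)))))
                  (product-cong λ k → reflexive (≡.cong (M (ρ k))
                    (≡.trans (insert-punchIn s j _ (punchIn t k)) (≡.cong (punchIn j) (insert-punchIn t l π k)))))))
        (solve 5 (λ a b w c p → (a :* (b :* w)) :* (c :* p) := (c :* (a :* b)) :* (w :* p)) refl _ _ _ _ _)

      sum-f-insert : ∀ j → sumOver (permutations (suc n)) (λ π → f (insert s j π)) ≈ N s j * H j
      sum-f-insert j = begin
        sumOver (permutations (suc n)) (λ π → f (insert s j π))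
          ≈⟨ sumOver-permutations-insert t (λ {α} {β} p → f-cong {insert s j α} {insert s j β} (insert-cong s j {α} {β} p)) ⟩
        sumOver (allFin (suc n)) (λ l → sumOver (permutations n) (λ π → f (insert s j (insert t l π))))
          ≈⟨ sumOver-cong (allFin (suc n)) (λ l → trans (sumOver-cong (permutations n) (f-insert j l))
               (trans (sumOver-*ˡ (permutations n) _ _) (trans (*-assoc _ _ _) (*-assoc _ _ _)))) ⟩
        sumOver (allFin (suc n)) (λ l → N s j * (N u (punchIn j l) * K j l))
          ≈⟨ sumOver-*ˡ (allFin (suc n)) _ _ ⟩
        N s j * H j ∎

      -- Once row `s` has taken column `s`, the γ entry of row `u` is no longer available and only
      -- its diagonal β remains. Every power of `η` then occurs twice and cancels.
      H-s : H s ≈ β * immanant Mρ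
      H-s = begin
        H s
          ≈⟨ sumOver-cong (allFin (suc n)) (λ l → *-congʳ (trans (N-t (punchIn s l))
               (reflexive (≡.cong₂ (λ a b → β * ⟦ a ⟧ + γ * ⟦ b ⟧) (≟-punchIn s t l) (dec-false (s ≟ punchIn s l) (punchInᵢ≢i s l ∘ ≡.sym)))))) ⟩
        sumOver (allFin (suc n)) (λ l → (β * ⟦ does (t ≟ l) ⟧ + γ * 0#) * K s l)
          -- The vanishing term is recast with coefficient 0 on the same column, so that
          -- `sumOver-δ₂` applies with both columns equal.
          ≈⟨ sumOver-cong (allFin (suc n)) (λ l → *-congʳ (+-congˡ (trans (zeroʳ _) (sym (zeroˡ _))))) ⟩
        sumOver (allFin (suc n)) (λ l → (β * ⟦ does (t ≟ l) ⟧ + 0# * ⟦ does (t ≟ l) ⟧) * K s l)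
          ≈⟨ sumOver-δ₂ t t β 0# (K s) ⟩
        β * K s t + 0# * K s t
          ≈⟨ trans (+-congˡ (zeroˡ _)) (+-identityʳ _) ⟩
        β * K s t
          ≈⟨ *-congˡ (trans (*-congʳ (trans (*-cong (^-double (toℕ s)) (^-double (toℕ t))) (*-identityˡ _))) (*-identityˡ _)) ⟩
        β * immanant Mρ ∎

      -- This is the swap: with column `u` taken, row `u` can only use column `s`, now at position
      -- `s′`. The leftover power of `η` is `η` itself, the weight of a transposition.
      H-u : H u ≈ γ * (η * immanant Mρ)
      H-u = begin
        H u
          ≈⟨ sumOver-cong (allFin (suc n)) (λ l → *-congʳ (trans (N-t (punchIn u l))
               (reflexive (≡.cong₂ (λ a b → β * ⟦ a ⟧ + γ * ⟦ b ⟧) (dec-false (u ≟ punchIn u l) (punchInᵢ≢i u l ∘ ≡.sym))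
                 (≡.trans (≡.cong (λ i → does (i ≟ punchIn u l)) (≡.sym (punchIn-unpunch s t))) (≟-punchIn u s′ l)))))) ⟩
        sumOver (allFin (suc n)) (λ l → (β * 0# + γ * ⟦ does (s′ ≟ l) ⟧) * K u l)
          ≈⟨ sumOver-cong (allFin (suc n)) (λ l → *-congʳ (+-congʳ (trans (zeroʳ _) (sym (zeroˡ _))))) ⟩
        sumOver (allFin (suc n)) (λ l → (0# * ⟦ does (s′ ≟ l) ⟧ + γ * ⟦ does (s′ ≟ l) ⟧) * K u l)
          ≈⟨ sumOver-δ₂ s′ s′ 0# γ (K u) ⟩
        0# * K u s′ + γ * K u s′
          ≈⟨ trans (+-congʳ (zeroˡ _)) (+-identityˡ _) ⟩
        γ * K u s′
          ≈⟨ *-congˡ (*-cong (^-unpunch s t) (immanant-cong (λ i j → reflexive (≡.cong (M (ρ i)) (punchIn-punchIn-comm s t j))))) ⟩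
        γ * (η * immanant Mρ) ∎

      sum-f : sumOver (permutations (suc (suc n))) f ≈ (β * β + η * (γ * γ)) * immanant Mρ
      sum-f = begin
        sumOver (permutations (suc (suc n))) f
          ≈⟨ sumOver-permutations-insert s (λ {α} {β} → f-cong {α} {β}) ⟩
        sumOver (allFin (suc (suc n))) (λ j → sumOver (permutations (suc n)) (λ π → f (insert s j π)))
          ≈⟨ sumOver-cong (allFin (suc (suc n))) (λ j → trans (sum-f-insert j) (*-congʳ (N-s j))) ⟩
        sumOver (allFin (suc (suc n))) (λ j → (β * ⟦ does (s ≟ j) ⟧ + γ * ⟦ does (u ≟ j) ⟧) * H j)
          ≈⟨ sumOver-δ₂ s u β γ H ⟩
        β * H s + γ * H u
          ≈⟨ +-cong (*-congˡ H-s) (*-congˡ H-u) ⟩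
        β * (β * immanant Mρ) + γ * (γ * (η * immanant Mρ))
          ≈⟨ solve 4 (λ b c h x → b :* (b :* x) :+ c :* (c :* (h :* x)) := (b :* b :+ h :* (c :* c)) :* x) refl β γ η (immanant Mρ) ⟩
        (β * β + η * (γ * γ)) * immanant Mρ ∎

    immanant-+-two-rows : immanant (λ i j → M i j + N i j) ≈
      immanant M + ∂immanant M N + (β * β + η * (γ * γ)) * immanant (delete s (punchIn s t) M)
    immanant-+-two-rows = begin
      immanant (λ i j → M i j + N i j)
        ≈⟨ sumOver-cong (permutations _) {λ α → weight α * product (λ k → M k (α ⟨$⟩ʳ k) + N k (α ⟨$⟩ʳ k))}
             (λ α → trans (*-congˡ (product-+-two s t (M along α) (N along α) (λ k → N-0 k _)))
               (trans (distribˡ _ _ _) (+-congʳ (distribˡ _ _ _)))) ⟩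
      sumOver (permutations (suc (suc n))) (λ α → weight α * product (M along α) + weight α * ∂ (M along α) (N along α) + f α)
        ≈⟨ trans (sumOver-+ (permutations (suc (suc n))) _ f) (+-cong (sumOver-+ (permutations (suc (suc n))) (λ α → weight α * product (M along α)) _) sum-f) ⟩
      immanant M + ∂immanant M N + (β * β + η * (γ * γ)) * immanant Mρ
        ≈⟨ +-congˡ (*-congˡ (immanant-delete s t M)) ⟨
      immanant M + ∂immanant M N + (β * β + η * (γ * γ)) * immanant (delete s (punchIn s t) M) ∎

  ∂immanant-congʳ : ∀ {n} (M : Matrix Carrier n) {N N′} → (∀ i j → N i j ≈ N′ i j) → ∂immanant M N ≈ ∂immanant M N′
  ∂immanant-congʳ {n} M p = sumOver-cong (permutations n) λ α → *-congˡ (∂-congʳ (M along α) λ k → p k _)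

  ∂immanant-+ : ∀ {n} (M N N′ : Matrix Carrier n) → ∂immanant M (λ i j → N i j + N′ i j) ≈ ∂immanant M N + ∂immanant M N′
  ∂immanant-+ {n} M N N′ = trans
    (sumOver-cong (permutations n) λ α → trans (*-congˡ (∂-+ (M along α) (N along α) (N′ along α))) (distribˡ _ _ _))
    (sumOver-+ (permutations n) _ _)

  ∂immanant-sumOver : ∀ {n i} {I : Set i} (xs : List I) (M : Matrix Carrier n) (N : I → Matrix Carrier n) →
    ∂immanant M (λ i j → sumOver xs (λ x → N x i j)) ≈ sumOver xs (λ x → ∂immanant M (N x))
  ∂immanant-sumOver {n} xs M N = trans
    (sumOver-cong (permutations n) λ α → trans (*-congˡ (∂-sumOver xs (M along α) (λ x → N x along α))) (sym (sumOver-*ˡ xs _ _)))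
    (sumOver-swap (permutations n) xs _)

  ∂immanant-diagonal : ∀ {n} (M : Matrix Carrier n) → ∂immanant M M ≈ fromℕ n * immanant M
  ∂immanant-diagonal {n} M = trans
    (sumOver-cong (permutations n) λ α → trans (*-congˡ (∂-diagonal (M along α)))
      (solve 3 (λ a b c → a :* (b :* c) := b :* (a :* c)) refl _ _ _))
    (sumOver-*ˡ (permutations n) _ _)

-- Derivations of a commutative ring.

record IsDerivation {c ℓ} (S : CommutativeRing c ℓ) (θ : CommutativeRing.Carrier S → CommutativeRing.Carrier S) : Set (c ⊔ ℓ) where
  open CommutativeRing S
  field
    θ-cong : ∀ {a b} → a ≈ b → θ a ≈ θ b
    θ-+    : ∀ a b → θ (a + b) ≈ θ a + θ b
    θ-*    : ∀ a b → θ (a * b) ≈ θ a * b + a * θ b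

module Derivations {c ℓ} (S : CommutativeRing c ℓ) {θ : CommutativeRing.Carrier S → CommutativeRing.Carrier S} (θ-isDerivation : IsDerivation S θ) where
  open CommutativeRing S hiding (zero)
  open IsDerivation θ-isDerivation
  open MatrixFunctions rawRing using (sumOver; fromℕ)
  open RawSemiringDefinitions (RawRing.rawSemiring rawRing) using (product; _^_)
  open RingProperties ring using (x+x≈x⇒x≈0)
  open Sums S
  open Products S
  open SetoidReasoning setoid

  θ-0 : θ 0# ≈ 0#
  θ-0 = x+x≈x⇒x≈0 _ (trans (sym (θ-+ _ _)) (θ-cong (+-identityˡ _)))

  θ-1 : θ 1# ≈ 0#
  θ-1 = x+x≈x⇒x≈0 _ (trans (+-cong (sym (*-identityʳ _)) (sym (*-identityˡ _))) (trans (sym (θ-* _ _)) (θ-cong (*-identityˡ _))))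

  θ-‿1 : θ (- 1#) ≈ 0#
  θ-‿1 = begin
    θ (- 1#)        ≈⟨ +-identityʳ _ ⟨
    θ (- 1#) + 0#   ≈⟨ +-congˡ θ-1 ⟨
    θ (- 1#) + θ 1# ≈⟨ θ-+ _ _ ⟨
    θ (- 1# + 1#)   ≈⟨ θ-cong (-‿inverseˡ _) ⟩
    θ 0#            ≈⟨ θ-0 ⟩
    0#              ∎

  θ-+-constant : ∀ {a b} → θ a ≈ 0# → θ b ≈ 0# → θ (a + b) ≈ 0#
  θ-+-constant p q = trans (θ-+ _ _) (trans (+-cong p q) (+-identityˡ _))

  θ-*-constantˡ : ∀ {a b} → θ a ≈ 0# → θ (a * b) ≈ a * θ b
  θ-*-constantˡ p = trans (θ-* _ _) (trans (+-congʳ (trans (*-congʳ p) (zeroˡ _))) (+-identityˡ _))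

  θ-*-constant : ∀ {a b} → θ a ≈ 0# → θ b ≈ 0# → θ (a * b) ≈ 0#
  θ-*-constant p q = trans (θ-*-constantˡ p) (trans (*-congˡ q) (zeroʳ _))

  θ-^-constant : ∀ {a} k → θ a ≈ 0# → θ (a ^ k) ≈ 0#
  θ-^-constant zero    p = θ-1
  θ-^-constant (suc k) p = θ-*-constant p (θ-^-constant k p)

  θ-fromℕ : ∀ k → θ (fromℕ k) ≈ 0#
  θ-fromℕ zero    = θ-0
  θ-fromℕ (suc k) = θ-+-constant θ-1 (θ-fromℕ k)

  θ-sumOver : ∀ {a} {A : Set a} (xs : List A) f → θ (sumOver xs f) ≈ sumOver xs (θ ∘ f)
  θ-sumOver []       f = θ-0
  θ-sumOver (x ∷ xs) f = trans (θ-+ _ _) (+-congˡ (θ-sumOver xs f))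

  -- The Leibniz rule, iterated, is the recursion that defines `∂`.
  θ-product : ∀ {n} (a : Fin n → Carrier) → θ (product a) ≈ ∂ a (θ ∘ a)
  θ-product {zero}  a = θ-1
  θ-product {suc n} a = trans (θ-* _ _) (+-congˡ (*-congˡ (θ-product (a ∘ suc))))

  module _ {η} (η*η≈1 : η * η ≈ 1#) (θη≈0 : θ η ≈ 0#) where
    open Immanants S η η*η≈1

    -- The weights are powers of `η`, hence constants for `θ`, so `θ` acts on the products alone.
    θ-immanant : ∀ {n} (M : Matrix Carrier n) → θ (immanant M) ≈ ∂immanant M (λ i j → θ (M i j))
    θ-immanant {n} M = trans (θ-sumOver (permutations n) _)
      (sumOver-cong (permutations n) λ α → trans (θ-*-constantˡ (θ-^-constant (inversions α) θη≈0)) (*-congˡ (θ-product (M along α))))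

-- Adjacency and degrees as sums over edges.

module GraphIncidence {c ℓ} (S : CommutativeRing c ℓ) where
  open CommutativeRing S hiding (zero)
  open MatrixFunctions rawRing
  open Sums S
  open SemiringSolver commutativeSemiring using (solve; _:=_; _:+_; _:*_; con)
  open SetoidReasoning setoid

  edgeMatrix : ∀ {n} → Fin n × Fin n → Matrix Carrier n
  edgeMatrix e i j = ⟦ joins e i j ⟧

  rowSum : ∀ {n} → Matrix Carrier n → Fin n → Carrier
  rowSum {n} M i = sumOver (allFin n) (M i)

  joins⇒adj : ∀ {n} (G : SimpleGraph n) s t → T (adj G s t) → ∀ i j → T (joins (s , t) i j) → T (adj G i j)
  joins⇒adj G s t st i j with i ≟ s | j ≟ t | i ≟ t | j ≟ s
  ... | yes ≡.refl | yes ≡.refl | _          | _          = λ _ → st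
  ... | yes _      | no _       | yes ≡.refl | yes ≡.refl = λ _ → ≡.subst T (adj-sym G s t) st
  ... | no _       | _          | yes ≡.refl | yes ≡.refl = λ _ → ≡.subst T (adj-sym G s t) st
  ... | yes _      | no _       | yes _      | no _       = λ ()
  ... | yes _      | no _       | no _       | _          = λ ()
  ... | no _       | _          | yes _      | no _       = λ ()
  ... | no _       | _          | no _       | _          = λ ()

  adjacencyMatrix-− : ∀ {n} (G : SimpleGraph n) s t → T (adj G s t) → ∀ i j →
    adjacencyMatrix G i j ≈ edgeMatrix (s , t) i j + adjacencyMatrix (G − (s , t)) i j
  adjacencyMatrix-− G s t st i j with adj G i j | joins (s , t) i j | joins⇒adj G s t st i j
  ... | true  | true  | _ = sym (+-identityʳ _)
  ... | true  | false | _ = sym (+-identityˡ _)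
  ... | false | false | _ = sym (+-identityˡ _)
  ... | false | true  | p with () ← p _

  fromℕ-degree : ∀ {n} (G : SimpleGraph n) i → fromℕ (degree G i) ≈ rowSum (adjacencyMatrix G) i
  fromℕ-degree {n} G i = begin
    fromℕ (degree G i)                                   ≈⟨ *-identityʳ _ ⟨
    fromℕ (degree G i) * 1#                              ≈⟨ sumOver-const (filter (λ u → T? (adj G i u)) (allFin n)) 1# ⟨
    sumOver (filter (λ u → T? (adj G i u)) (allFin n)) _ ≈⟨ sumOver-filter (λ u → T? (adj G i u)) (allFin n) _ ⟩
    sumOver (allFin n) (λ u → ⟦ adj G i u ⟧ * 1#)        ≈⟨ sumOver-cong (allFin n) (λ u → *-identityʳ _) ⟩
    rowSum (adjacencyMatrix G) i                         ∎

  -- This makes D linear in A, so that the effect of deleting an edge and the sum over edges need be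
  -- worked out for A only.
  degreeMatrix-rowSum : ∀ {n} (G : SimpleGraph n) i j → degreeMatrix G i j ≈ ⟦ does (i ≟ j) ⟧ * rowSum (adjacencyMatrix G) i
  degreeMatrix-rowSum G i j with does (i ≟ j)
  ... | true  = trans (fromℕ-degree G i) (sym (*-identityˡ _))
  ... | false = sym (zeroˡ _)

  -- The disjunction in `joins` becomes a sum because its two cases exclude each other for `s ≢ t`;
  -- for equal endpoints the factor with `lt s t` vanishes. The indicators stand outermost, ready
  -- for `sumOver-allFin-δ`.
  edgeMatrix-split : ∀ {n} (s t : Fin n) b i j → ⟦ lt s t ∧ b ⟧ * edgeMatrix (s , t) i j ≈
    ⟦ does (i ≟ s) ⟧ * (⟦ does (j ≟ t) ⟧ * ⟦ lt s t ∧ b ⟧) + ⟦ does (j ≟ s) ⟧ * (⟦ does (i ≟ t) ⟧ * ⟦ lt s t ∧ b ⟧)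
  edgeMatrix-split s t b i j with s ≟ t
  edgeMatrix-split s t b i j | yes ≡.refl rewrite lt-irrefl s =
    solve 3 (λ e x y → con 0 :* e := x :* (y :* con 0) :+ y :* (x :* con 0)) refl _ _ _
  edgeMatrix-split s t b i j | no s≢t with i ≟ s | i ≟ t
  ... | yes i≡s | yes i≡t = contradiction (≡.trans (≡.sym i≡s) i≡t) s≢t
  ... | yes _   | no _    = split (does (j ≟ t)) ⟦ does (j ≟ s) ⟧
    where
    split : ∀ d z → ⟦ lt s t ∧ b ⟧ * ⟦ d ∨ false ⟧ ≈ 1# * (⟦ d ⟧ * ⟦ lt s t ∧ b ⟧) + z * (0# * ⟦ lt s t ∧ b ⟧)
    split true  z = solve 2 (λ h z → h :* con 1 := con 1 :* (con 1 :* h) :+ z :* (con 0 :* h)) refl _ z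
    split false z = solve 2 (λ h z → h :* con 0 := con 1 :* (con 0 :* h) :+ z :* (con 0 :* h)) refl _ z
  ... | no _    | yes _   = solve 3 (λ h d z → h :* d := con 0 :* (z :* h) :+ d :* (con 1 :* h)) refl _ _ _
  ... | no _    | no _    = solve 3 (λ h d z → h :* con 0 := con 0 :* (z :* h) :+ d :* (con 0 :* h)) refl _ _ _

  -- An edge between `i` and `j` is listed in just one orientation, since for distinct indices
  -- exactly one of `i < j` and `j < i` holds; on the diagonal both sides vanish.
  sumOver-edgeMatrix : ∀ {n} (G : SimpleGraph n) i j → sumOver (edges G) (λ e → edgeMatrix e i j) ≈ adjacencyMatrix G i j
  sumOver-edgeMatrix {n} G i j = begin
    sumOver (edges G) (λ e → edgeMatrix e i j)
      ≈⟨ sumOver-filter (λ (s , t) → (s <? t) ×-dec T? (adj G s t)) (cartesianProduct (allFin n) (allFin n)) _ ⟩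
    sumOver (cartesianProduct (allFin n) (allFin n)) (λ (s , t) → h s t * edgeMatrix (s , t) i j)
      ≈⟨ sumOver-cartesianProductWith _,_ (allFin n) (allFin n) _ ⟩
    sumOver (allFin n) (λ s → sumOver (allFin n) (λ t → h s t * edgeMatrix (s , t) i j))
      ≈⟨ sumOver-cong (allFin n) (λ s → trans (sumOver-cong (allFin n) (λ t → edgeMatrix-split s t (adj G s t) i j))
           (trans (sumOver-+ (allFin n) _ _) (+-cong
             (trans (sumOver-*ˡ (allFin n) _ _) (*-congˡ (sumOver-allFin-δ j (h s))))
             (trans (sumOver-*ˡ (allFin n) _ _) (*-congˡ (sumOver-allFin-δ i (h s))))))) ⟩
    sumOver (allFin n) (λ s → ⟦ does (i ≟ s) ⟧ * h s j + ⟦ does (j ≟ s) ⟧ * h s i)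
      ≈⟨ trans (sumOver-+ (allFin n) _ _) (+-cong (sumOver-allFin-δ i (λ s → h s j)) (sumOver-allFin-δ j (λ s → h s i))) ⟩
    h i j + h j i
      ≈⟨ both i j ⟩
    adjacencyMatrix G i j ∎
    where
    h : Fin n → Fin n → Carrier
    h s t = ⟦ lt s t ∧ adj G s t ⟧

    complement : ∀ p a → ⟦ not p ∧ a ⟧ + ⟦ p ∧ a ⟧ ≈ ⟦ a ⟧
    complement true  a = +-identityˡ _
    complement false a = +-identityʳ _

    lt-connex : ∀ {n} (i j : Fin n) → i ≢ j → lt i j ≡ not (lt j i)
    lt-connex {suc n} i j i≢j = ≡.subst (λ k → lt i k ≡ not (lt k i)) (punchIn-punchOut i≢j) (lt-flip i (punchOut i≢j))

    both : ∀ i j → h i j + h j i ≈ adjacencyMatrix G i j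
    both i j with i ≟ j
    ... | yes ≡.refl rewrite lt-irrefl i | adj-irrefl G i = +-identityˡ _
    ... | no i≢j rewrite adj-sym G j i | lt-connex i j i≢j = complement (lt j i) (adj G i j)

-- The identity for weighted immanants over a ring with derivation.

module GraphIdentity {c ℓ} (S : CommutativeRing c ℓ)
  {θ : CommutativeRing.Carrier S → CommutativeRing.Carrier S} (θ-isDerivation : IsDerivation S θ)
  (x β γ η : CommutativeRing.Carrier S) (θx≈x : CommutativeRing._≈_ S (θ x) x)
  (θβ≈0 : CommutativeRing._≈_ S (θ β) (CommutativeRing.0# S)) (θγ≈0 : CommutativeRing._≈_ S (θ γ) (CommutativeRing.0# S)) (θη≈0 : CommutativeRing._≈_ S (θ η) (CommutativeRing.0# S))
  (η*η≈1 : CommutativeRing._≈_ S (CommutativeRing._*_ S η η) (CommutativeRing.1# S)) where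
  open CommutativeRing S hiding (zero)
  open IsDerivation θ-isDerivation
  open MatrixFunctions rawRing
  open Sums S
  open Immanants S η η*η≈1
  open Derivations S θ-isDerivation
  open GraphIncidence S
  open RingProperties ring using (+-cancelʳ; -‿distribˡ-*)
  open SemiringSolver commutativeSemiring using (solve; _:=_; _:+_; _:*_; con)
  open SetoidReasoning setoid

  -- The bracketing is that of `graphMatrix`, so the two agree by computation over the polynomial
  -- ring.
  matrix : ∀ {n} → SimpleGraph n → Matrix Carrier n
  matrix G i j = (x * identityMatrix i j + - (β * degreeMatrix G i j)) + - (γ * adjacencyMatrix G i j)

  weightedMatrix : ∀ {n} → SimpleGraph n → Matrix Carrier n
  weightedMatrix G i j = β * degreeMatrix G i j + γ * adjacencyMatrix G i j

  -- The matrix Nₑ, written as β D + γ A for the graph whose only edge is `e`, with row sums as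
  -- degrees. This form is visibly additive over edges.
  increment : ∀ {n} → Fin n × Fin n → Matrix Carrier n
  increment e i j = β * (⟦ does (i ≟ j) ⟧ * rowSum (edgeMatrix e) i) + γ * edgeMatrix e i j

  matrix+weightedMatrix : ∀ {n} (G : SimpleGraph n) i j → matrix G i j + weightedMatrix G i j ≈ x * identityMatrix i j
  matrix+weightedMatrix G i j = begin
    ((a + - b) + - d) + (b + d) ≈⟨ solve 5 (λ a b b′ d d′ → ((a :+ b′) :+ d′) :+ (b :+ d) := a :+ ((b :+ b′) :+ (d :+ d′))) refl a b (- b) d (- d) ⟩
    a + ((b + - b) + (d + - d)) ≈⟨ +-congˡ (trans (+-cong (-‿inverseʳ b) (-‿inverseʳ d)) (+-identityˡ _)) ⟩
    a + 0#                      ≈⟨ +-identityʳ a ⟩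
    a                           ∎
    where
    a = x * identityMatrix i j
    b = β * degreeMatrix G i j
    d = γ * adjacencyMatrix G i j

  θ-identityMatrix : ∀ {n} (i j : Fin n) → θ (identityMatrix i j) ≈ 0#
  θ-identityMatrix i j with does (i ≟ j)
  ... | true  = θ-1
  ... | false = θ-0

  θ-weightedMatrix : ∀ {n} (G : SimpleGraph n) i j → θ (weightedMatrix G i j) ≈ 0#
  θ-weightedMatrix G i j = θ-+-constant (θ-*-constant θβ≈0 θ-degree) (θ-*-constant θγ≈0 θ-adjacency)
    where
    θ-degree : θ (degreeMatrix G i j) ≈ 0#
    θ-degree with does (i ≟ j)
    ... | true  = θ-fromℕ (degree G i)
    ... | false = θ-0
    θ-adjacency : θ (adjacencyMatrix G i j) ≈ 0#
    θ-adjacency with adj G i j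
    ... | true  = θ-1
    ... | false = θ-0

  -- Adding the constant β D + γ A changes nothing under `θ` and removes all negations before `θ` is
  -- evaluated.
  θ-matrix : ∀ {n} (G : SimpleGraph n) i j → θ (matrix G i j) ≈ x * identityMatrix i j
  θ-matrix G i j = begin
    θ (matrix G i j)                              ≈⟨ +-identityʳ _ ⟨
    θ (matrix G i j) + 0#                         ≈⟨ +-congˡ (θ-weightedMatrix G i j) ⟨
    θ (matrix G i j) + θ (weightedMatrix G i j)   ≈⟨ θ-+ _ _ ⟨
    θ (matrix G i j + weightedMatrix G i j)       ≈⟨ θ-cong (matrix+weightedMatrix G i j) ⟩
    θ (x * identityMatrix i j)                    ≈⟨ θ-* _ _ ⟩
    θ x * identityMatrix i j + x * θ (identityMatrix i j) ≈⟨ +-cong (*-congʳ θx≈x) (trans (*-congˡ (θ-identityMatrix i j)) (zeroʳ _)) ⟩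
    x * identityMatrix i j + 0#                   ≈⟨ +-identityʳ _ ⟩
    x * identityMatrix i j                        ∎

  weightedMatrix-− : ∀ {n} (G : SimpleGraph n) s t → T (adj G s t) → ∀ i j →
    weightedMatrix G i j ≈ increment (s , t) i j + weightedMatrix (G − (s , t)) i j
  weightedMatrix-− {n} G s t st i j = begin
    β * degreeMatrix G i j + γ * adjacencyMatrix G i j
      ≈⟨ +-cong (*-congˡ (trans (degreeMatrix-rowSum G i j) (*-congˡ (trans
           (sumOver-cong (allFin n) (adjacencyMatrix-− G s t st i)) (sumOver-+ (allFin n) _ _)))))
           (*-congˡ (adjacencyMatrix-− G s t st i j)) ⟩
    β * (⟦ does (i ≟ j) ⟧ * (rowSum (edgeMatrix (s , t)) i + rowSum (adjacencyMatrix (G − (s , t))) i))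
      + γ * (edgeMatrix (s , t) i j + adjacencyMatrix (G − (s , t)) i j)
      ≈⟨ solve 7 (λ b c d r r′ a a′ → b :* (d :* (r :+ r′)) :+ c :* (a :+ a′) := (b :* (d :* r) :+ c :* a) :+ (b :* (d :* r′) :+ c :* a′))
           refl β γ _ _ _ _ _ ⟩
    increment (s , t) i j + (β * (⟦ does (i ≟ j) ⟧ * rowSum (adjacencyMatrix (G − (s , t))) i) + γ * adjacencyMatrix (G − (s , t)) i j)
      ≈⟨ +-congˡ (+-congʳ (*-congˡ (degreeMatrix-rowSum (G − (s , t)) i j))) ⟨
    increment (s , t) i j + weightedMatrix (G − (s , t)) i j ∎

  -- For both graphs the matrix and its β D + γ A add up to the same x I, so the increment lost by
  -- the one is gained by the other.
  matrix-− : ∀ {n} (G : SimpleGraph n) s t → T (adj G s t) → ∀ i j → matrix (G − (s , t)) i j ≈ matrix G i j + increment (s , t) i j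
  matrix-− G s t st i j = +-cancelʳ (weightedMatrix (G − (s , t)) i j) _ _ (begin
    matrix (G − (s , t)) i j + weightedMatrix (G − (s , t)) i j ≈⟨ matrix+weightedMatrix (G − (s , t)) i j ⟩
    x * identityMatrix i j                                      ≈⟨ matrix+weightedMatrix G i j ⟨
    matrix G i j + weightedMatrix G i j                         ≈⟨ +-congˡ (weightedMatrix-− G s t st i j) ⟩
    matrix G i j + (increment (s , t) i j + weightedMatrix (G − (s , t)) i j) ≈⟨ +-assoc _ _ _ ⟨
    (matrix G i j + increment (s , t) i j) + weightedMatrix (G − (s , t)) i j ∎)

  sumOver-increment : ∀ {n} (G : SimpleGraph n) i j → sumOver (edges G) (λ e → increment e i j) ≈ weightedMatrix G i j
  sumOver-increment {n} G i j = begin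
    sumOver (edges G) (λ e → increment e i j)
      ≈⟨ trans (sumOver-+ (edges G) _ _) (+-cong
           (trans (sumOver-*ˡ (edges G) β _) (*-congˡ (trans (sumOver-*ˡ (edges G) _ _) (*-congˡ (sumOver-swap (edges G) (allFin n) _)))))
           (sumOver-*ˡ (edges G) γ _)) ⟩
    β * (⟦ does (i ≟ j) ⟧ * sumOver (allFin n) (λ u → sumOver (edges G) (λ e → edgeMatrix e i u))) + γ * sumOver (edges G) (λ e → edgeMatrix e i j)
      ≈⟨ +-cong (*-congˡ (*-congˡ (sumOver-cong (allFin n) (sumOver-edgeMatrix G i)))) (*-congˡ (sumOver-edgeMatrix G i j)) ⟩
    β * (⟦ does (i ≟ j) ⟧ * rowSum (adjacencyMatrix G) i) + γ * adjacencyMatrix G i j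
      ≈⟨ +-congʳ (*-congˡ (degreeMatrix-rowSum G i j)) ⟨
    weightedMatrix G i j ∎

  module _ {n} {s t : Fin n} (s≢t : s ≢ t) where

    private
      -- An endpoint `i` has the single neighbour `k` in the one-edge graph, so its row sum is 1.
      increment-row : ∀ i k → (∀ j → joins (s , t) i j ≡ does (k ≟ j)) → ∀ j → increment (s , t) i j ≈ β * ⟦ does (i ≟ j) ⟧ + γ * ⟦ does (k ≟ j) ⟧
      increment-row i k p j = +-cong
        (*-congˡ (trans (*-congˡ (trans (sumOver-cong (allFin n) (λ u → trans (reflexive (≡.cong ⟦_⟧ (p u))) (sym (*-identityʳ _))))
          (sumOver-allFin-δ k (λ _ → 1#)))) (*-identityʳ _)))
        (*-congˡ (reflexive (≡.cong ⟦_⟧ (p j))))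

    increment-s : ∀ j → increment (s , t) s j ≈ β * ⟦ does (s ≟ j) ⟧ + γ * ⟦ does (t ≟ j) ⟧
    increment-s = increment-row s t λ j → ≡.trans
      (≡.cong₂ (λ a b → (a ∧ does (j ≟ t)) ∨ (b ∧ does (j ≟ s))) (dec-true (s ≟ s) ≡.refl) (dec-false (s ≟ t) s≢t))
      (≡.trans (∨-identityʳ _) (≟-sym j t))

    increment-t : ∀ j → increment (s , t) t j ≈ β * ⟦ does (t ≟ j) ⟧ + γ * ⟦ does (s ≟ j) ⟧
    increment-t = increment-row t s λ j → ≡.trans
      (≡.cong₂ (λ a b → (a ∧ does (j ≟ t)) ∨ (b ∧ does (j ≟ s))) (dec-false (t ≟ s) (s≢t ∘ ≡.sym)) (dec-true (t ≟ t) ≡.refl))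
      (≟-sym j s)

    increment-0 : ∀ i → i ≢ s → i ≢ t → ∀ j → increment (s , t) i j ≈ 0#
    increment-0 i i≢s i≢t j = trans
      (+-cong (*-congˡ (*-congˡ (trans (sumOver-cong (allFin n) none) (sumOver-0 (allFin n))))) (*-congˡ (none j)))
      (solve 3 (λ b d c → b :* (d :* con 0) :+ c :* con 0 := con 0) refl β _ γ)
      where
      none : ∀ j → edgeMatrix (s , t) i j ≈ 0#
      none j = reflexive (≡.cong₂ (λ a b → ⟦ (a ∧ does (j ≟ t)) ∨ (b ∧ does (j ≟ s)) ⟧) (dec-false (i ≟ s) i≢s) (dec-false (i ≟ t) i≢t))

  -- Any `t` distinct from `s` is `punchIn s` of its `punchOut`, which reduces the claim to
  -- `immanant-+-two-rows`; with a single index no such `t` exists.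
  immanant-+-increment : ∀ {n} (M : Matrix Carrier n) (s t : Fin n) → s ≢ t → immanant (λ i j → M i j + increment (s , t) i j) ≈
    immanant M + ∂immanant M (increment (s , t)) + (β * β + η * (γ * γ)) * immanant (delete s t M)
  immanant-+-increment {suc zero}    M zero zero s≢t = contradiction ≡.refl s≢t
  immanant-+-increment {suc (suc n)} M s t s≢t =
    ≡.subst (λ t → immanant (λ i j → M i j + increment (s , t) i j) ≈
                     immanant M + ∂immanant M (increment (s , t)) + (β * β + η * (γ * γ)) * immanant (delete s t M))
      (punchIn-punchOut s≢t) (punched (punchOut s≢t))
    where
    punched : ∀ t → let u = punchIn s t in immanant (λ i j → M i j + increment (s , u) i j) ≈
      immanant M + ∂immanant M (increment (s , u)) + (β * β + η * (γ * γ)) * immanant (delete s u M)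
    punched t = immanant-+-two-rows β γ M (increment (s , punchIn s t)) s t (increment-s s≢u) (increment-t s≢u)
      (λ k → increment-0 s≢u _ (punchInᵢ≢i s _) (punchInᵢ≢i t k ∘ punchIn-injective s _ _))
      where
      s≢u : s ≢ punchIn s t
      s≢u = punchInᵢ≢i s t ∘ ≡.sym

  edges-valid : ∀ {n} (G : SimpleGraph n) → All (λ (s , t) → s < t × T (adj G s t)) (edges G)
  edges-valid {n} G = Allₚ.all-filter (λ (s , t) → (s <? t) ×-dec T? (adj G s t)) (cartesianProduct (allFin n) (allFin n))

  ∂immanant-weightedMatrix : ∀ {n} (G : SimpleGraph n) → let M = matrix G in
    fromℕ n * immanant M + ∂immanant M (weightedMatrix G) ≈ θ (immanant M)
  ∂immanant-weightedMatrix {n} G = begin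
    fromℕ n * immanant M + ∂immanant M (weightedMatrix G)   ≈⟨ +-congʳ (∂immanant-diagonal M) ⟨
    ∂immanant M M + ∂immanant M (weightedMatrix G)          ≈⟨ ∂immanant-+ M M (weightedMatrix G) ⟨
    ∂immanant M (λ i j → M i j + weightedMatrix G i j)      ≈⟨ ∂immanant-congʳ M (λ i j → trans (matrix+weightedMatrix G i j) (sym (θ-matrix G i j))) ⟩
    ∂immanant M (λ i j → θ (M i j))                         ≈⟨ θ-immanant η*η≈1 θη≈0 M ⟨
    θ (immanant M)                                          ∎
    where M = matrix G

  immanant-identity : ∀ {n} (G : SimpleGraph n) → let M = matrix G in
    (fromℕ (length (edges G)) + - fromℕ n) * immanant M + θ (immanant M) ≈
    sumOver (edges G) (λ e → immanant (matrix (G − e))) + - ((β * β + η * (γ * γ)) * sumOver (edges G) (λ (s , t) → immanant (delete s t M)))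
  immanant-identity {n} G = begin
    (m + - k) * F + θ F
      ≈⟨ +-cong (trans (distribʳ _ _ _) (+-congˡ (sym (-‿distribˡ-* _ _)))) (sym (∂immanant-weightedMatrix G)) ⟩
    (m * F + - (k * F)) + (k * F + L)
      ≈⟨ solve 4 (λ a b b′ l → (a :+ b′) :+ (b :+ l) := (b :+ b′) :+ (a :+ l)) refl (m * F) (k * F) (- (k * F)) L ⟩
    (k * F + - (k * F)) + (m * F + L)
      -- Here -n from the coefficient cancels the n of Euler's identity. The zero is rewritten as
      -- `X + - X`, because `X` is what the remaining terms lack to form the sum over deleted edges.
      ≈⟨ +-congʳ (trans (-‿inverseʳ _) (sym (-‿inverseʳ _))) ⟩
    (X + - X) + (m * F + L)
      ≈⟨ solve 3 (λ x x′ a → (x :+ x′) :+ a := (a :+ x) :+ x′) refl X (- X) (m * F + L) ⟩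
    (m * F + L + X) + - X
      ≈⟨ +-congʳ total ⟨
    sumOver (edges G) (λ e → immanant (matrix (G − e))) + - X ∎
    where
    M = matrix G
    F = immanant M
    m = fromℕ (length (edges G))
    k = fromℕ n
    L = ∂immanant M (weightedMatrix G)
    κ = β * β + η * (γ * γ)
    X = κ * sumOver (edges G) (λ (s , t) → immanant (delete s t M))

    total : sumOver (edges G) (λ e → immanant (matrix (G − e))) ≈ m * F + L + X
    total = begin
      sumOver (edges G) (λ e → immanant (matrix (G − e)))
        ≈⟨ sumOver-cong-All (edges-valid G) (λ (s , t) (s<t , st) → trans
             (immanant-cong (matrix-− G s t st)) (immanant-+-increment M s t (<⇒≢ s<t))) ⟩
      sumOver (edges G) (λ e@(s , t) → F + ∂immanant M (increment e) + κ * immanant (delete s t M))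
        ≈⟨ trans (sumOver-+ (edges G) _ _) (+-cong (sumOver-+ (edges G) _ _) (sumOver-*ˡ (edges G) κ _)) ⟩
      sumOver (edges G) (λ _ → F) + sumOver (edges G) (λ e → ∂immanant M (increment e)) + X
        ≈⟨ +-congʳ (+-cong (sumOver-const (edges G) F) (trans (sym (∂immanant-sumOver (edges G) M increment))
             (∂immanant-congʳ M (sumOver-increment G)))) ⟩
      m * F + L + X ∎

-- Specialisation to η = -1 and η = 1.

module DeterminantAndPermanent {c ℓ} (S : CommutativeRing c ℓ)
  {θ : CommutativeRing.Carrier S → CommutativeRing.Carrier S} (θ-isDerivation : IsDerivation S θ)
  (x β γ β² γ² : CommutativeRing.Carrier S) (θx≈x : CommutativeRing._≈_ S (θ x) x)
  (θβ≈0 : CommutativeRing._≈_ S (θ β) (CommutativeRing.0# S)) (θγ≈0 : CommutativeRing._≈_ S (θ γ) (CommutativeRing.0# S))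
  (β²≈β*β : CommutativeRing._≈_ S β² (CommutativeRing._*_ S β β)) (γ²≈γ*γ : CommutativeRing._≈_ S γ² (CommutativeRing._*_ S γ γ)) where
  open CommutativeRing S hiding (zero)
  open IsDerivation θ-isDerivation
  open MatrixFunctions rawRing
  open Sums S
  open Derivations S θ-isDerivation
  open RingProperties ring using (-‿distribˡ-*; -‿involutive; -‿+-comm; -1*x≈-x)
  open RawSemiringDefinitions (RawRing.rawSemiring rawRing) using (_^_)
  open SetoidReasoning setoid

  private
    module Det = GraphIdentity S θ-isDerivation x β γ (- 1#) θx≈x θβ≈0 θγ≈0 θ-‿1 (trans (-1*x≈-x _) (-‿involutive _))
    module Per = GraphIdentity S θ-isDerivation x β γ 1# θx≈x θβ≈0 θγ≈0 θ-1 (*-identityˡ 1#)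
  open Per using (matrix)

  -- At η = -1 the weight is `sign` by definition, so only the coefficient of the minors has to be
  -- rewritten. The squares are separate parameters because the constant polynomial of a product is
  -- merely equivalent to the product of the constants.
  det-identity : ∀ {n} (G : SimpleGraph n) →
    (fromℕ (length (edges G)) + - fromℕ n) * det (matrix G) + θ (det (matrix G)) ≈
    sumOver (edges G) (λ e → det (matrix (G − e))) + (γ² + - β²) * sumOver (edges G) (λ (s , t) → det (delete s t (matrix G)))
  det-identity G = trans (Det.immanant-identity G) (+-congˡ (trans (-‿distribˡ-* _ _) (*-congʳ κ)))
    where
    κ : - (β * β + - 1# * (γ * γ)) ≈ γ² + - β²
    κ = begin
      - (β * β + - 1# * (γ * γ))     ≈⟨ -‿+-comm _ _ ⟨
      - (β * β) + - (- 1# * (γ * γ)) ≈⟨ +-comm _ _ ⟩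
      - (- 1# * (γ * γ)) + - (β * β) ≈⟨ +-congʳ (trans (-‿cong (-1*x≈-x _)) (-‿involutive _)) ⟩
      γ * γ + - (β * β)              ≈⟨ +-cong γ²≈γ*γ (-‿cong β²≈β*β) ⟨
      γ² + - β²                      ∎

  -- Unlike `det`, `per` carries no weights, so the powers of 1 in the immanant must be removed
  -- first.
  per-identity : ∀ {n} (G : SimpleGraph n) →
    (fromℕ (length (edges G)) + - fromℕ n) * per (matrix G) + θ (per (matrix G)) ≈
    sumOver (edges G) (λ e → per (matrix (G − e))) + - ((γ² + β²) * sumOver (edges G) (λ (s , t) → per (delete s t (matrix G))))
  per-identity {n} G = begin
    (fromℕ (length (edges G)) + - fromℕ n) * per M + θ (per M)
      ≈⟨ +-cong (*-congˡ (immanant≈per M)) (θ-cong (immanant≈per M)) ⟨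
    (fromℕ (length (edges G)) + - fromℕ n) * immanant M + θ (immanant M)
      ≈⟨ Per.immanant-identity G ⟩
    sumOver (edges G) (λ e → immanant (matrix (G − e))) + - ((β * β + 1# * (γ * γ)) * sumOver (edges G) (λ (s , t) → immanant (delete s t M)))
      ≈⟨ +-cong (sumOver-cong (edges G) (λ e → immanant≈per (matrix (G − e))))
           (-‿cong (*-cong κ (sumOver-cong (edges G) (λ (s , t) → immanant≈per (delete s t M))))) ⟩
    sumOver (edges G) (λ e → per (matrix (G − e))) + - ((γ² + β²) * sumOver (edges G) (λ (s , t) → per (delete s t M))) ∎
    where
    open Immanants S 1# (*-identityˡ 1#) using (immanant)
    M = matrix G

    1^k≈1 : ∀ k → 1# ^ k ≈ 1#
    1^k≈1 zero    = refl
    1^k≈1 (suc k) = trans (*-identityˡ _) (1^k≈1 k)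

    immanant≈per : ∀ {n} (M : Matrix Carrier n) → immanant M ≈ per M
    immanant≈per {n} M = sumOver-cong (permutations n) λ α → trans (*-congʳ (1^k≈1 (inversions α))) (*-identityˡ _)

    κ : β * β + 1# * (γ * γ) ≈ γ² + β²
    κ = trans (+-comm _ _) (+-cong (trans (*-identityˡ _) (sym γ²≈γ*γ)) (sym β²≈β*β))

-- The polynomial ring and its Euler operator.

module PolynomialRing {c ℓ} (R : CommutativeRing c ℓ) where
  open CommutativeRing R hiding (zero)
  open Polynomials rawRing hiding (rawRing)
  open SemiringMult semiring using (×-congʳ) renaming (_×_ to _×ᵣ_)
  open RingProperties ring using (-0#≈0#)
  open SemiringSolver commutativeSemiring using (solve; _:=_; _:+_; _:*_; con)
  open SetoidReasoning setoid

  Seq : Set c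
  Seq = ℕ → Carrier

  -- The Cauchy product on infinite sequences. Polynomials are compared by coefficients, so the ring
  -- laws are proved here, where trailing zeros do not matter, and pulled back along `coeff`.
  conv : Seq → Seq → Seq
  conv f g zero    = f 0 * g 0
  conv f g (suc k) = f 0 * g (suc k) + conv (f ∘ suc) g k

  conv-cong : ∀ {f f′ g g′ : Seq} → (∀ k → f k ≈ f′ k) → (∀ k → g k ≈ g′ k) → ∀ k → conv f g k ≈ conv f′ g′ k
  conv-cong p q zero    = *-cong (p 0) (q 0)
  conv-cong p q (suc k) = +-cong (*-cong (p 0) (q (suc k))) (conv-cong (p ∘ suc) q k)

  conv-zeroˡ : ∀ {f : Seq} g → (∀ k → f k ≈ 0#) → ∀ k → conv f g k ≈ 0#
  conv-zeroˡ g p zero    = trans (*-congʳ (p 0)) (zeroˡ _)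
  conv-zeroˡ g p (suc k) = trans (+-cong (trans (*-congʳ (p 0)) (zeroˡ _)) (conv-zeroˡ g (p ∘ suc) k)) (+-identityˡ _)

  -- The mirror image of the defining recursion, with the last term split off; commutativity comes
  -- from playing one against the other.
  conv-suc : ∀ f g k → conv f g (suc k) ≈ conv f (g ∘ suc) k + f (suc k) * g 0
  conv-suc f g zero    = refl
  conv-suc f g (suc k) = trans (+-congˡ (conv-suc (f ∘ suc) g k)) (sym (+-assoc _ _ _))

  conv-comm : ∀ f g k → conv f g k ≈ conv g f k
  conv-comm f g zero    = *-comm _ _
  conv-comm f g (suc k) = begin
    f 0 * g (suc k) + conv (f ∘ suc) g k ≈⟨ +-cong (*-comm _ _) (conv-comm (f ∘ suc) g k) ⟩
    g (suc k) * f 0 + conv g (f ∘ suc) k ≈⟨ +-comm _ _ ⟩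
    conv g (f ∘ suc) k + g (suc k) * f 0 ≈⟨ conv-suc g f k ⟨
    conv g f (suc k)                     ∎

  conv-distribʳ : ∀ f f′ g k → conv (λ i → f i + f′ i) g k ≈ conv f g k + conv f′ g k
  conv-distribʳ f f′ g zero    = distribʳ _ _ _
  conv-distribʳ f f′ g (suc k) = trans (+-congˡ (conv-distribʳ (f ∘ suc) (f′ ∘ suc) g k))
    (solve 5 (λ a b c d e → (a :+ b) :* c :+ (d :+ e) := (a :* c :+ d) :+ (b :* c :+ e)) refl _ _ _ _ _)

  conv-scaleˡ : ∀ a f g k → conv (λ i → a * f i) g k ≈ a * conv f g k
  conv-scaleˡ a f g zero    = *-assoc _ _ _
  conv-scaleˡ a f g (suc k) = trans (+-cong (*-assoc _ _ _) (conv-scaleˡ a (f ∘ suc) g k)) (sym (distribˡ _ _ _))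

  conv-assoc : ∀ f g h k → conv (conv f g) h k ≈ conv f (conv g h) k
  conv-assoc f g h zero    = *-assoc _ _ _
  conv-assoc f g h (suc k) = begin
    (f 0 * g 0) * h (suc k) + conv (λ i → f 0 * g (suc i) + conv (f ∘ suc) g i) h k
      ≈⟨ +-congˡ (trans (conv-distribʳ _ _ h k) (+-cong (conv-scaleˡ (f 0) (g ∘ suc) h k) (conv-assoc (f ∘ suc) g h k))) ⟩
    (f 0 * g 0) * h (suc k) + (f 0 * conv (g ∘ suc) h k + conv (f ∘ suc) (conv g h) k)
      ≈⟨ solve 5 (λ a b c d e → (a :* b) :* c :+ (a :* d :+ e) := a :* (b :* c :+ d) :+ e) refl _ _ _ _ _ ⟩
    f 0 * (g 0 * h (suc k) + conv (g ∘ suc) h k) + conv (f ∘ suc) (conv g h) k ∎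

  ×-zero : ∀ n → n ×ᵣ 0# ≈ 0#
  ×-zero zero    = refl
  ×-zero (suc n) = trans (+-identityˡ _) (×-zero n)

  ×-+ : ∀ n {a b} → n ×ᵣ (a + b) ≈ n ×ᵣ a + n ×ᵣ b
  ×-+ zero    = sym (+-identityˡ _)
  ×-+ (suc n) = trans (+-congˡ (×-+ n)) (solve 4 (λ a b c d → (a :+ b) :+ (c :+ d) := (a :+ c) :+ (b :+ d)) refl _ _ _ _)

  ×-*ʳ : ∀ n {a b} → n ×ᵣ (a * b) ≈ a * (n ×ᵣ b)
  ×-*ʳ zero    = sym (zeroʳ _)
  ×-*ʳ (suc n) = trans (+-congˡ (×-*ʳ n)) (sym (distribˡ _ _ _))

  -- The Leibniz rule for `θ` on coefficients: in each term of the convolution the two indices add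
  -- up to `k`.
  conv-index : ∀ f g k → k ×ᵣ conv f g k ≈ conv (λ i → i ×ᵣ f i) g k + conv f (λ i → i ×ᵣ g i) k
  conv-index f g zero    = sym (trans (+-cong (zeroˡ _) (zeroʳ _)) (+-identityˡ _))
  conv-index f g (suc k) = begin
    suc k ×ᵣ (f 0 * g (suc k) + conv (f ∘ suc) g k)
      ≈⟨ ×-+ (suc k) ⟩
    suc k ×ᵣ (f 0 * g (suc k)) + (conv (f ∘ suc) g k + k ×ᵣ conv (f ∘ suc) g k)
      ≈⟨ +-cong (×-*ʳ (suc k)) (+-congˡ (conv-index (f ∘ suc) g k)) ⟩
    f 0 * (suc k ×ᵣ g (suc k)) + (conv (f ∘ suc) g k + (conv (λ i → i ×ᵣ f (suc i)) g k + conv (f ∘ suc) (λ i → i ×ᵣ g i) k))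
      -- The spare copy of `conv (f ∘ suc) g k` raises the factor of `f (suc i)` from `i` to
      -- `suc i`; the term with `con 0` is that of index 0.
      ≈⟨ solve 5 (λ a b c d e → a :+ (b :+ (c :+ d)) := (con 0 :* e :+ (b :+ c)) :+ (a :+ d)) refl _ _ _ _ (g (suc k)) ⟩
    (0# * g (suc k) + (conv (f ∘ suc) g k + conv (λ i → i ×ᵣ f (suc i)) g k)) + (f 0 * (suc k ×ᵣ g (suc k)) + conv (f ∘ suc) (λ i → i ×ᵣ g i) k)
      ≈⟨ +-congʳ (+-congˡ (conv-distribʳ _ _ g k)) ⟨
    conv (λ i → i ×ᵣ f i) g (suc k) + conv f (λ i → i ×ᵣ g i) (suc k) ∎

  coeff-+ : ∀ p q k → coeff (p +ₚ q) k ≈ coeff p k + coeff q k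
  coeff-+ []      q       k       = sym (+-identityˡ _)
  coeff-+ (a ∷ p) []      k       = sym (+-identityʳ _)
  coeff-+ (a ∷ p) (b ∷ q) zero    = refl
  coeff-+ (a ∷ p) (b ∷ q) (suc k) = coeff-+ p q k

  coeff-neg : ∀ p k → coeff (-ₚ p) k ≈ - coeff p k
  coeff-neg []      k       = sym -0#≈0#
  coeff-neg (a ∷ p) zero    = refl
  coeff-neg (a ∷ p) (suc k) = coeff-neg p k

  coeff-scale : ∀ a p k → coeff (map (a *_) p) k ≈ a * coeff p k
  coeff-scale a []      k       = sym (zeroʳ _)
  coeff-scale a (b ∷ p) zero    = refl
  coeff-scale a (b ∷ p) (suc k) = coeff-scale a p k

  coeff-* : ∀ p q k → coeff (p *ₚ q) k ≈ conv (coeff p) (coeff q) k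
  coeff-* []      q k       = sym (conv-zeroˡ (coeff q) (λ _ → refl) k)
  coeff-* (a ∷ p) q zero    = trans (coeff-+ (map (a *_) q) _ 0) (trans (+-identityʳ _) (coeff-scale a q 0))
  coeff-* (a ∷ p) q (suc k) = trans (coeff-+ (map (a *_) q) _ (suc k)) (+-cong (coeff-scale a q (suc k)) (coeff-* p q k))

  private
    +-via : ∀ p q {f g : Seq} → (∀ k → coeff p k ≈ f k) → (∀ k → coeff q k ≈ g k) → ∀ k → coeff (p +ₚ q) k ≈ f k + g k
    +-via p q u v k = trans (coeff-+ p q k) (+-cong (u k) (v k))

    *-via : ∀ p q {f g : Seq} → (∀ k → coeff p k ≈ f k) → (∀ k → coeff q k ≈ g k) → ∀ k → coeff (p *ₚ q) k ≈ conv f g k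
    *-via p q u v k = trans (coeff-* p q k) (conv-cong u v k)

    same : ∀ {p} k → coeff p k ≈ coeff p k
    same k = refl

  *ₚ-comm : ∀ p q → p *ₚ q ≈ₚ q *ₚ p
  *ₚ-comm p q = mk≈ₚ λ k → trans (coeff-* p q k) (trans (conv-comm _ _ k) (sym (coeff-* q p k)))

  *ₚ-identityˡ : ∀ p → const 1# *ₚ p ≈ₚ p
  *ₚ-identityˡ p = mk≈ₚ λ k → trans (coeff-* (const 1#) p k) (conv-1 k)
    where
    conv-1 : ∀ k → conv (coeff (const 1#)) (coeff p) k ≈ coeff p k
    conv-1 zero    = *-identityˡ _
    conv-1 (suc k) = trans (+-cong (*-identityˡ _) (conv-zeroˡ (coeff p) (λ _ → refl) k)) (+-identityʳ _)

  *ₚ-distribʳ-+ₚ : ∀ p q r → (q +ₚ r) *ₚ p ≈ₚ q *ₚ p +ₚ r *ₚ p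
  *ₚ-distribʳ-+ₚ p q r = mk≈ₚ λ k → trans (*-via (q +ₚ r) p (coeff-+ q r) (same {p}) k)
    (trans (conv-distribʳ _ _ _ k) (sym (+-via (q *ₚ p) (r *ₚ p) (coeff-* q p) (coeff-* r p) k)))

  ≈ₚ-trans : ∀ {p q r} → p ≈ₚ q → q ≈ₚ r → p ≈ₚ r
  ≈ₚ-trans p q = mk≈ₚ λ k → trans (coeff-≈ p k) (coeff-≈ q k)

  +ₚ-comm : ∀ p q → p +ₚ q ≈ₚ q +ₚ p
  +ₚ-comm p q = mk≈ₚ λ k → trans (coeff-+ p q k) (trans (+-comm _ _) (sym (coeff-+ q p k)))

  +ₚ-cong : ∀ {p p′ q q′} → p ≈ₚ p′ → q ≈ₚ q′ → p +ₚ q ≈ₚ p′ +ₚ q′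
  +ₚ-cong {p} {p′} {q} {q′} u v = mk≈ₚ λ k → trans (+-via p q (coeff-≈ u) (coeff-≈ v) k) (sym (coeff-+ p′ q′ k))

  +ₚ-inverseʳ : ∀ p → p +ₚ (-ₚ p) ≈ₚ []
  +ₚ-inverseʳ p = mk≈ₚ λ k → trans (+-via p (-ₚ p) (same {p}) (coeff-neg p) k) (-‿inverseʳ _)

  polynomialRing : CommutativeRing c ℓ
  polynomialRing = record
    { Carrier = Poly ; _≈_ = _≈ₚ_ ; _+_ = _+ₚ_ ; _*_ = _*ₚ_ ; -_ = -ₚ_ ; 0# = [] ; 1# = const 1#
    ; isCommutativeRing = record
      { isRing = record
        { +-isAbelianGroup = record
          { isGroup = record
            { isMonoid = record
              { isSemigroup = record
                { isMagma = record
                  { isEquivalence = record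
                    { refl  = mk≈ₚ λ k → refl
                    ; sym   = λ u → mk≈ₚ λ k → sym (coeff-≈ u k)
                    ; trans = ≈ₚ-trans
                    }
                  ; ∙-cong = +ₚ-cong
                  }
                ; assoc = λ p q r → mk≈ₚ λ k → trans (+-via (p +ₚ q) r (coeff-+ p q) (same {r}) k)
                    (trans (+-assoc _ _ _) (sym (+-via p (q +ₚ r) (same {p}) (coeff-+ q r) k)))
                }
              ; identity = (λ p → mk≈ₚ λ k → refl) , (λ p → +ₚ-comm p [])
              }
            ; inverse = (λ p → ≈ₚ-trans (+ₚ-comm (-ₚ p) p) (+ₚ-inverseʳ p)) , +ₚ-inverseʳ
            ; ⁻¹-cong = λ {p} {q} u → mk≈ₚ λ k → trans (coeff-neg p k) (trans (-‿cong (coeff-≈ u k)) (sym (coeff-neg q k)))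
            }
          ; comm = +ₚ-comm
          }
        ; *-cong = λ {p} {p′} {q} {q′} u v → mk≈ₚ λ k → trans (*-via p q (coeff-≈ u) (coeff-≈ v) k) (sym (coeff-* p′ q′ k))
        ; *-assoc = λ p q r → mk≈ₚ λ k → trans (*-via (p *ₚ q) r (coeff-* p q) (same {r}) k)
            (trans (conv-assoc _ _ _ k) (sym (*-via p (q *ₚ r) (same {p}) (coeff-* q r) k)))
        ; *-identity = *ₚ-identityˡ , (λ p → ≈ₚ-trans (*ₚ-comm p _) (*ₚ-identityˡ p))
        ; distrib = (λ p q r → ≈ₚ-trans (*ₚ-comm p _) (≈ₚ-trans (*ₚ-distribʳ-+ₚ p q r) (+ₚ-cong (*ₚ-comm q p) (*ₚ-comm r p))))
            , *ₚ-distribʳ-+ₚ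
        }
      ; *-comm = *ₚ-comm
      }
    }

  θ : Poly → Poly
  θ p = var *ₚ derivative p

  coeff-scaleByIndexFrom : ∀ j p k → coeff (scaleByIndexFrom j p) k ≈ (k ℕ.+ j) ×ᵣ coeff p k
  coeff-scaleByIndexFrom j []      k       = sym (×-zero (k ℕ.+ j))
  coeff-scaleByIndexFrom j (a ∷ p) zero    = refl
  coeff-scaleByIndexFrom j (a ∷ p) (suc k) = trans (coeff-scaleByIndexFrom (suc j) p k)
    (reflexive (≡.cong (_×ᵣ coeff p k) (ℕₚ.+-suc k j)))

  coeff-derivative : ∀ p k → coeff (derivative p) k ≈ suc k ×ᵣ coeff p (suc k)
  coeff-derivative []      k = sym (×-zero (suc k))
  coeff-derivative (a ∷ p) k = trans (coeff-scaleByIndexFrom 1 p k) (reflexive (≡.cong (_×ᵣ coeff p k) (ℕₚ.+-comm k 1)))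

  coeff-var* : ∀ p k → coeff (var *ₚ p) (suc k) ≈ coeff p k
  coeff-var* p k = trans (coeff-+ (map (0# *_) p) _ (suc k))
    (trans (+-cong (trans (coeff-scale 0# p (suc k)) (zeroˡ _)) (coeff-≈ (*ₚ-identityˡ p) k)) (+-identityˡ _))

  -- The derivative shifts indices down and multiplication by `var` shifts them back, so `θ` acts
  -- diagonally on coefficients.
  coeff-θ : ∀ p k → coeff (θ p) k ≈ k ×ᵣ coeff p k
  coeff-θ p zero    = trans (coeff-* var (derivative p) 0) (zeroˡ _)
  coeff-θ p (suc k) = trans (coeff-var* (derivative p) k) (coeff-derivative p k)

  θ-isDerivation : IsDerivation polynomialRing θ
  θ-isDerivation = record
    { θ-cong = λ {p} {q} u → mk≈ₚ λ k → trans (coeff-θ p k) (trans (×-congʳ k (coeff-≈ u k)) (sym (coeff-θ q k)))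
    ; θ-+    = λ p q → mk≈ₚ λ k → trans (coeff-θ (p +ₚ q) k) (trans (×-congʳ k (coeff-+ p q k))
                 (trans (×-+ k) (sym (+-via (θ p) (θ q) (coeff-θ p) (coeff-θ q) k))))
    ; θ-*    = λ p q → mk≈ₚ λ k → trans (coeff-θ (p *ₚ q) k) (trans (×-congʳ k (coeff-* p q k))
                 (trans (conv-index (coeff p) (coeff q) k)
                   (sym (+-via (θ p *ₚ q) (p *ₚ θ q) (*-via (θ p) q (coeff-θ p) (same {q})) (*-via p (θ q) (same {p}) (coeff-θ q)) k))))
    }

  θ-const : ∀ a → θ (const a) ≈ₚ []
  θ-const a = mk≈ₚ λ { zero → coeff-θ (const a) 0 ; (suc k) → trans (coeff-θ (const a) (suc k)) (×-zero (suc k)) }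

  θ-var : θ var ≈ₚ var
  θ-var = mk≈ₚ λ
    { zero          → coeff-θ var 0
    ; (suc zero)    → trans (coeff-θ var 1) (+-identityʳ _)
    ; (suc (suc k)) → trans (coeff-θ var (suc (suc k))) (×-zero (suc (suc k)))
    }

  const-* : ∀ a b → const (a * b) ≈ₚ const a *ₚ const b
  const-* a b = mk≈ₚ λ { zero → sym (+-identityʳ _) ; (suc k) → refl }

-- The identities over the real numbers.

open import Defs

theorem3p1 : (β γ : ℝ) → ¬ (γ ≃ fromℚ 0ℚ) →
    (n : ℕ) (G : SimpleGraph n) →
    let m = length (edges G)
        M = graphMatrix β γ G
        β² = const (β *ᵣ β)
        γ² = const (γ *ᵣ γ)
    in
    ((fromℕ m -ₚ fromℕ n) *ₚ τ₁ β γ G +ₚ var *ₚ derivative (τ₁ β γ G)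
      ≈ₚ sumOver (edges G) (λ e → τ₁ β γ (G − e))
         +ₚ (γ² -ₚ β²) *ₚ sumOver (edges G) (λ (s , t) → det (delete s t M)))
    ×
    ((fromℕ m -ₚ fromℕ n) *ₚ τ₂ β γ G +ₚ var *ₚ derivative (τ₂ β γ G)
      ≈ₚ sumOver (edges G) (λ e → τ₂ β γ (G − e))
         -ₚ (γ² +ₚ β²) *ₚ sumOver (edges G) (λ (s , t) → per (delete s t M)))
theorem3p1 β γ _ n G = det-identity G , per-identity G
  where
  open PolynomialRing ℝ-commutativeRing using (polynomialRing; θ-isDerivation; θ-var; θ-const; const-*)
  open DeterminantAndPermanent polynomialRing θ-isDerivation var (const β) (const γ) (const (β *ᵣ β)) (const (γ *ᵣ γ))
    θ-var (θ-const β) (θ-const γ) (const-* β β) (const-* γ γ)
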